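{- Let $n$ and $k$ be integers with $1 \leq k < n/2$, and let $\mathrm{GP}(n,k)$ be the generalized Petersen graph. \begin{enumerate} \item[(i)] If $n$ is odd, then $\mathrm{GP}(n,k)$ is stable. \item[(ii)] $\mathrm{GP}(n,k)$ is trivially unstable if and only if $n$ is even and $k$ is odd. \item[(iii)] If both $n$ and $k$ are even, then $\mathrm{GP}(n,k)$ is nontrivially unstable if and only if $k^2\equiv \pm 1 \pmod{n/2}$ or $n=4k$. \end{enumerate}
   Context: For integers $1\le k<n/2$, the generalized Petersen graph $\mathrm{GP}(n,k)$ is the cubic graph with vertices $u_0,\dots,u_{n-1},v_0,\dots,v_{n-1}$ and edges $\{u_i,u_{i+1}\}$, $\{u_i,v_i\}$, $\{v_i,v_{i+k}\}$ for $i\in\{0,\dots,n-1\}$ (subscripts mod $n$). The canonical double cover $D(\Gamma)$ of a graph $\Gamma$ is the direct product $\Gamma\times K_2$: vertex set $V(\Gamma)\times\mathbb{Z}_2$, with $(u,x)\sim(v,y)$ iff $u\sim v$ in $\Gamma$ and $x\ne y$. Always $\mathrm{Aut}(D(\Gamma))\ge \mathrm{Aut}(\Gamma)\times\mathbb{Z}_2$. A graph $\Gamma$ is stable if $\mathrm{Aut}(D(\Gamma))=\mathrm{Aut}(\Gamma)\times\mathbb{Z}_2$ and unstable otherwise. A graph is vertex-determining if no two distinct vertices have the same neighborhood. An unstable graph is nontrivially unstable if it is connected, non-bipartite and vertex-determining, and trivially unstable otherwise. -}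

module Defs where

open import Data.Nat using (ℕ; _+_; _*_)
open import Data.Fin using (Fin; toℕ)
open import Data.Bool using (Bool; true; false; _xor_)
open import Data.Product using (Σ; ∃; _×_; _,_)
open import Data.Sum using (_⊎_)
open import Relation.Binary.PropositionalEquality using (_≡_; _≢_)
open import Relation.Nullary using (¬_)
open import Function.Bundles using (_⇔_)

record Graph : Set₁ where
  field
    V   : Set
    Adj : V → V → Set
open Graph public

infix 4 _≋_[mod_]
_≋_[mod_] : ℕ → ℕ → ℕ → Set
a ≋ b [mod m ] = Σ ℕ (λ q → (a ≡ b + q * m) ⊎ (b ≡ a + q * m))

-- Generalized Petersen graph GP(n,k):
-- vertex (false , i) is u_i, vertex (true , i) is v_i.
data GPAdj (n k : ℕ) : Bool × Fin n → Bool × Fin n → Set where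
  uu₊ : ∀ {i j} → (toℕ i + 1) ≋ toℕ j [mod n ] → GPAdj n k (false , i) (false , j)
  uu₋ : ∀ {i j} → (toℕ j + 1) ≋ toℕ i [mod n ] → GPAdj n k (false , i) (false , j)
  uv  : ∀ {i} → GPAdj n k (false , i) (true , i)
  vu  : ∀ {i} → GPAdj n k (true , i) (false , i)
  vv₊ : ∀ {i j} → (toℕ i + k) ≋ toℕ j [mod n ] → GPAdj n k (true , i) (true , j)
  vv₋ : ∀ {i j} → (toℕ j + k) ≋ toℕ i [mod n ] → GPAdj n k (true , i) (true , j)

GP : ℕ → ℕ → Graph
GP n k = record { V = Bool × Fin n ; Adj = GPAdj n k }

DoubleCover : Graph → Graph
DoubleCover G = record
  { V = V G × Bool
  ; Adj = λ { (u , x) (v , y) → Adj G u v × (x ≢ y) } }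

record Aut (G : Graph) : Set where
  field
    fun      : V G → V G
    inv      : V G → V G
    inv-left  : ∀ x → inv (fun x) ≡ x
    inv-right : ∀ x → fun (inv x) ≡ x
    adj      : ∀ x y → Adj G x y ⇔ Adj G (fun x) (fun y)
open Aut public

-- Stable: every automorphism of D(Γ) lies in the canonical copy of
-- Aut(Γ) × ℤ₂, i.e. is (v , x) ↦ (σ v , x + c) with σ ∈ Aut(Γ), c ∈ ℤ₂.
Stable : Graph → Set
Stable G = (φ : Aut (DoubleCover G)) →
  Σ (Aut G) λ σ → Σ Bool λ c → ∀ v x → fun φ (v , x) ≡ (fun σ v , x xor c)

Unstable : Graph → Set
Unstable G = ¬ Stable G

data Walk (G : Graph) : V G → V G → Set where
  here : ∀ {u} → Walk G u u
  step : ∀ {u v w} → Adj G u v → Walk G v w → Walk G u w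

Connected : Graph → Set
Connected G = ∀ u v → Walk G u v

Bipartite : Graph → Set
Bipartite G = Σ (V G → Bool) λ c → ∀ u v → Adj G u v → c u ≢ c v

VertexDetermining : Graph → Set
VertexDetermining G = ∀ u v → (∀ w → Adj G u w ⇔ Adj G v w) → u ≡ v

NontriviallyUnstable : Graph → Set
NontriviallyUnstable G =
  Unstable G × Connected G × ¬ Bipartite G × VertexDetermining G

TriviallyUnstable : Graph → Set
TriviallyUnstable G =
  Unstable G × ¬ (Connected G × ¬ Bipartite G × VertexDetermining G)

{-# OPTIONS --safe #-}

-- Let D be the canonical double cover and τ (v , x) = (v , x + 1). GP(n,k) is connected, so it is stable
-- if and only if every automorphism of D commutes with τ.
--
-- An automorphism preserves the number of closed non-backtracking walks of length 8 through an arc. Such a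
-- walk changes the index by some a + b k, so these numbers depend only on which of finitely many a + b k
-- vanish modulo n. If a spoke is moved to a rim edge, then outer, inner and spoke arcs have equal numbers;
-- for n odd, or n and k even, this forces n ≤ 60, and then (n,k) = (5,2), (13,5) or one of the exceptions
-- of the theorem. Walks of length 10 settle (13,5); D(GP(5,2)) is the Desargues graph, where τ is the
-- antipodal map.
--
-- An automorphism preserving spokes maps rim walks to rim walks. For n odd, τ is n steps along either rim.
-- For n and k even, an outer vertex is joined to its τ-image by two mirror-image walks (spoke, inner step,
-- spoke, k outer steps back); their images end at the same vertex, which gives commutation with τ unless
-- n | 4k or n | 2(k² ± 1). In these exceptional cases, and for n even and k odd, an explicit automorphism
-- treats the two parity classes of D differently.
module Submission where

open import Defs

-- Length 8 is chosen because outer step, spoke, inner step, spoke, reversed outer step, spoke,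
-- reversed inner step, spoke is a closed walk for every `n` and `k`. It accounts for four walks
-- through a spoke arc but only two through a rim arc (the first entries of the tallies), so the
-- counts can agree only if further shifts a + b k vanish modulo n. Each such relation gives n | a²
-- - b² k²; two opposite ones, or two with different slopes, eliminate k and leave n dividing a
-- fixed constant, the largest being 4 · 4² - 2² = 60. Nothing infinite survives, and the remaining
-- pairs are settled by evaluation. No count can help for (5,2): the Desargues graph is
-- arc-transitive, so its automorphisms do move spokes to rim edges and commutation with τ has to
-- come from distances instead. In the unstable cases the parity of index plus layer splits D into
-- two classes, well defined because n is even. How the inner edges behave with respect to this
-- splitting decides which maps can be applied to one class only.

module GeneralizedPetersen where

  open import Data.Bool.Base using (Bool; true; false; not; if_then_else_; _xor_; _∧_; T)
  import Data.Bool.Properties as Bool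
  open import Data.Empty using (⊥-elim)
  open import Data.Fin.Base using (Fin; toℕ; fromℕ<)
  import Data.Fin.Properties as Fin
  open import Data.Fin.Properties using (toℕ-fromℕ<; toℕ-injective; toℕ<n)
  open import Data.Integer.Base using (ℤ; +_; _+_; _-_; _*_; -_; ∣_∣; _⊖_; -[1+_]; _%ℕ_; _/ℕ_)
  open import Data.Integer.DivMod using (n%ℕd<d; a≡a%ℕn+[a/ℕn]*n)
  open import Data.Integer.Divisibility.Signed
    using (_∣_; _∣?_; divides; ∣-trans; ∣⇒∣ᵤ; ∣ᵤ⇒∣; ∣m∣n⇒∣m+n; ∣n⇒∣m*n)
  import Data.Integer.Properties as ℤ
  open import Data.Integer.Tactic.RingSolver using (solve-∀)
  open import Data.List.Base using (List; []; _∷_; _++_; map; zip; foldr)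
  open import Data.List.Properties using (map-++)
  open import Data.Nat as ℕ using (ℕ; zero; suc; NonZero; s≤s; z≤n)
  open import Data.Nat.Coprimality using (Coprime; coprime-divisor)
  import Data.Nat.Divisibility as ℕ
  import Data.Nat.DivMod as ℕ
  open import Data.Nat.ListAction using (sum)
  open import Data.Nat.ListAction.Properties using (sum-++)
  import Data.Nat.Properties as ℕ
  open import Data.Nat.Tactic.RingSolver renaming (solve-∀ to ℕ-solve-∀)
  open import Data.Product.Base using (∃; _×_; _,_; proj₁; proj₂)
  open import Data.Product.Properties using (≡-dec)
  open import Data.Sum.Base using (_⊎_; inj₁; inj₂)
  open import Data.Unit.Base using (tt)
  open import Function.Base using (_∘_)
  open import Function.Bundles using (_⇔_; mk⇔; Equivalence)
  open import Relation.Binary.Definitions using (DecidableEquality)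
  open import Relation.Binary.PropositionalEquality
    using (_≡_; _≢_; refl; sym; trans; cong; cong₂; subst; subst₂; module ≡-Reasoning)
  open import Relation.Nullary using (¬_; Dec; yes; no; does)
  open import Relation.Nullary.Decidable
    using (¬?; _×-dec_; _⊎-dec_; _→-dec_; map′; does-⇔; dec-true; dec-false; from-yes; from-no; False; toWitness; toWitnessFalse; isYes≗does)

  -- Residues modulo n

  ∣-lin₁ : ∀ {n x z} c → + n ∣ x → z ≡ c * x → + n ∣ z
  ∣-lin₁ c p refl = ∣n⇒∣m*n c p

  ∣-lin₂ : ∀ {n x y z} c d → + n ∣ x → + n ∣ y → z ≡ c * x + d * y → + n ∣ z
  ∣-lin₂ c d p q refl = ∣m∣n⇒∣m+n (∣n⇒∣m*n c p) (∣n⇒∣m*n d q)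

  ∤-between : ∀ {n c} → 0 ℕ.< c → c ℕ.< n → ¬ (+ n ∣ + c)
  ∤-between {c = suc c} _ c<n p = ℕ.<⇒≱ c<n (ℕ.∣⇒≤ (∣⇒∣ᵤ p))

  ≋⇒∣ : ∀ {a b n} → a ≋ b [mod n ] → + n ∣ + a - + b
  ≋⇒∣ {b = b} {n} (q , inj₁ refl) = divides (+ q) (trans (cong (_- + b) (trans (ℤ.pos-+ b (q ℕ.* n)) (cong (λ z → + b + z) (ℤ.pos-* q n)))) (eq (+ b) (+ q * + n)))
    where
    eq : ∀ x y → x + y - x ≡ y
    eq = solve-∀
  ≋⇒∣ {a} {n = n} (q , inj₂ refl) = divides (- + q) (trans (cong (λ z → + a - z) (trans (ℤ.pos-+ a (q ℕ.* n)) (cong (λ z → + a + z) (ℤ.pos-* q n)))) (eq (+ a) (+ q) (+ n)))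
    where
    eq : ∀ x y z → x - (x + y * z) ≡ - y * z
    eq = solve-∀

  ∣⇒≋ : ∀ {a b n} → + n ∣ + a - + b → a ≋ b [mod n ]
  ∣⇒≋ {a} {b} {n} (divides (+ q) e) = q , inj₁ (ℤ.+-injective (trans (eq (+ a) (+ b)) (trans (cong (λ z → + b + z) (trans e (sym (ℤ.pos-* q n)))) (sym (ℤ.pos-+ b (q ℕ.* n))))))
    where
    eq : ∀ x y → x ≡ y + (x - y)
    eq = solve-∀
  ∣⇒≋ {a} {b} {n} (divides -[1+ q ] e) = suc q , inj₂ (ℤ.+-injective (trans (eq (+ a) (+ b)) (trans (cong (λ z → + a - z) e) (trans (eq′ (+ a) (+ suc q) (+ n)) (trans (cong (λ z → + a + z) (sym (ℤ.pos-* (suc q) n))) (sym (ℤ.pos-+ a (suc q ℕ.* n))))))))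
    where
    eq : ∀ x y → y ≡ x - (x - y)
    eq = solve-∀
    eq′ : ∀ x y z → x - (- y * z) ≡ x + y * z
    eq′ = solve-∀

  module Residue (n : ℕ) {{_ : NonZero n}} where

    opaque
      ⟦_⟧ : ℤ → Fin n
      ⟦ z ⟧ = fromℕ< (n%ℕd<d z n)

      ⟦⟧-≈ : ∀ z → + n ∣ + toℕ ⟦ z ⟧ - z
      ⟦⟧-≈ z = divides (- (z /ℕ n)) (trans (cong₂ (λ r y → + r - y) (toℕ-fromℕ< _) (a≡a%ℕn+[a/ℕn]*n z n)) (eq (+ (z %ℕ n)) (z /ℕ n) (+ n)))
        where
        eq : ∀ r q m → r - (r + q * m) ≡ - q * m
        eq = solve-∀

    toℕ-≈ : ∀ {i j : Fin n} → + n ∣ + toℕ i - + toℕ j → i ≡ j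
    toℕ-≈ {i} {j} p = toℕ-injective (residue-≡ (∣⇒≋ p))
      where
      large : ∀ {a b} → a ℕ.< n → b ℕ.< n → ∀ q → a ≡ b ℕ.+ q ℕ.* n → a ≡ b
      large {b = b} _ _ zero refl = ℕ.+-identityʳ b
      large {b = b} a<n _ (suc q) refl = ⊥-elim (ℕ.<⇒≱ a<n (ℕ.≤-trans (ℕ.m≤m+n n (q ℕ.* n)) (ℕ.m≤n+m _ b)))
      residue-≡ : toℕ i ≋ toℕ j [mod n ] → toℕ i ≡ toℕ j
      residue-≡ (q , inj₁ e) = large (toℕ<n i) (toℕ<n j) q e
      residue-≡ (q , inj₂ e) = sym (large (toℕ<n j) (toℕ<n i) q e)

    ⟦⟧-cong : ∀ {y z} → + n ∣ y - z → ⟦ y ⟧ ≡ ⟦ z ⟧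
    ⟦⟧-cong {y} {z} p = toℕ-≈ (∣-lin₂ (+ 1) (+ 1) (∣-lin₂ (+ 1) (- + 1) (⟦⟧-≈ y) (⟦⟧-≈ z) refl) p (eq (+ toℕ ⟦ y ⟧) (+ toℕ ⟦ z ⟧) y z))
      where
      eq : ∀ a b y z → a - b ≡ + 1 * (+ 1 * (a - y) + - + 1 * (b - z)) + + 1 * (y - z)
      eq = solve-∀

    ⟦⟧-injective : ∀ {y z} → ⟦ y ⟧ ≡ ⟦ z ⟧ → + n ∣ y - z
    ⟦⟧-injective {y} {z} e = ∣-lin₂ (+ 1) (- + 1) (⟦⟧-≈ z) (⟦⟧-≈ y) (trans (eq (+ toℕ ⟦ z ⟧) y z) (cong (λ i → + 1 * (+ toℕ ⟦ z ⟧ - z) + - + 1 * (+ toℕ i - y)) (sym e)))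
      where
      eq : ∀ a y z → y - z ≡ + 1 * (a - z) + - + 1 * (a - y)
      eq = solve-∀

    ⟦toℕ⟧ : ∀ i → ⟦ + toℕ i ⟧ ≡ i
    ⟦toℕ⟧ i = toℕ-≈ (⟦⟧-≈ (+ toℕ i))

    infixl 6 _⊕_

    opaque
      _⊕_ : Fin n → ℤ → Fin n
      i ⊕ z = ⟦ + toℕ i + z ⟧

      ⊕-cong : ∀ {i y z} → + n ∣ y - z → i ⊕ y ≡ i ⊕ z
      ⊕-cong {i} {y} {z} p = ⟦⟧-cong (∣-lin₁ (+ 1) p (eq (+ toℕ i) y z))
        where
        eq : ∀ a y z → (a + y) - (a + z) ≡ + 1 * (y - z)
        eq = solve-∀

      ⊕-injective : ∀ {i y z} → i ⊕ y ≡ i ⊕ z → + n ∣ y - z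
      ⊕-injective {i} {y} {z} e = ∣-lin₁ (+ 1) (⟦⟧-injective e) (eq (+ toℕ i) y z)
        where
        eq : ∀ a y z → y - z ≡ + 1 * ((a + y) - (a + z))
        eq = solve-∀

      ⊕-assoc : ∀ i y z → (i ⊕ y) ⊕ z ≡ i ⊕ (y + z)
      ⊕-assoc i y z = ⟦⟧-cong (∣-lin₁ (+ 1) (⟦⟧-≈ (+ toℕ i + y)) (eq (+ toℕ (i ⊕ y)) (+ toℕ i) y z))
        where
        eq : ∀ b a y z → (b + z) - (a + (y + z)) ≡ + 1 * (b - (a + y))
        eq = solve-∀

      ⊕-zero : ∀ {i z} → + n ∣ z → i ⊕ z ≡ i
      ⊕-zero {i} {z} p = trans (⟦⟧-cong (∣-lin₁ (+ 1) p (eq (+ toℕ i) z))) (⟦toℕ⟧ i)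
        where
        eq : ∀ a z → (a + z) - a ≡ + 1 * z
        eq = solve-∀

      ⊕-fixed : ∀ {i z} → i ⊕ z ≡ i → + n ∣ z
      ⊕-fixed {i} {z} e = ∣-lin₁ (+ 1) (⟦⟧-injective (trans e (sym (⟦toℕ⟧ i)))) (eq (+ toℕ i) z)
        where
        eq : ∀ a z → z ≡ + 1 * ((a + z) - a)
        eq = solve-∀

      ⊕≡⟦⟧ : ∀ i z → i ⊕ z ≡ ⟦ + toℕ i + z ⟧
      ⊕≡⟦⟧ i z = refl

      ⊕-≈ : ∀ i z → + n ∣ + toℕ (i ⊕ z) - (+ toℕ i + z)
      ⊕-≈ i z = ⟦⟧-≈ (+ toℕ i + z)

  -- Non-backtracking walks and their shifts

  -- The three edges at a vertex: the two rim directions and the spoke.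
  data Letter : Set where
    fwd bwd spoke : Letter

  back : Letter → Letter
  back fwd = bwd
  back bwd = fwd
  back spoke = spoke

  others : Letter → Letter × Letter
  others fwd = bwd , spoke
  others bwd = fwd , spoke
  others spoke = fwd , bwd

  flip : Bool → Letter → Bool
  flip t spoke = not t
  flip t _     = t

  _≟ᴸ_ : DecidableEquality Letter
  fwd ≟ᴸ fwd = yes refl
  fwd ≟ᴸ bwd = no λ ()
  fwd ≟ᴸ spoke = no λ ()
  bwd ≟ᴸ fwd = no λ ()
  bwd ≟ᴸ bwd = yes refl
  bwd ≟ᴸ spoke = no λ ()
  spoke ≟ᴸ fwd = no λ ()
  spoke ≟ᴸ bwd = no λ ()
  spoke ≟ᴸ spoke = yes refl

  Σ≠ : Letter → (Letter → ℕ) → ℕ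
  Σ≠ b g = g (proj₁ (others b)) ℕ.+ g (proj₂ (others b))

  Σᴸ : (Letter → ℕ) → ℕ
  Σᴸ g = g fwd ℕ.+ g bwd ℕ.+ g spoke

  Σ≠-complement : ∀ b g → g b ℕ.+ Σ≠ b g ≡ Σᴸ g
  Σ≠-complement fwd g = sym (ℕ.+-assoc (g fwd) (g bwd) (g spoke))
  Σ≠-complement bwd g = eq (g fwd) (g bwd) (g spoke)
    where
    eq : ∀ x y z → y ℕ.+ (x ℕ.+ z) ≡ x ℕ.+ y ℕ.+ z
    eq = ℕ-solve-∀
  Σ≠-complement spoke g = ℕ.+-comm (g spoke) (g fwd ℕ.+ g bwd)

  Σᴸ-permute : ∀ g a b c → a ≢ b → a ≢ c → b ≢ c → g a ℕ.+ g b ℕ.+ g c ≡ Σᴸ g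
  Σᴸ-permute g a b c = go a b c
    where
    x = g fwd
    y = g bwd
    z = g spoke
    bca : ∀ x y z → y ℕ.+ z ℕ.+ x ≡ x ℕ.+ y ℕ.+ z
    bca = ℕ-solve-∀
    cab : ∀ x y z → z ℕ.+ x ℕ.+ y ≡ x ℕ.+ y ℕ.+ z
    cab = ℕ-solve-∀
    acb : ∀ x y z → x ℕ.+ z ℕ.+ y ≡ x ℕ.+ y ℕ.+ z
    acb = ℕ-solve-∀
    bac : ∀ x y z → y ℕ.+ x ℕ.+ z ≡ x ℕ.+ y ℕ.+ z
    bac = ℕ-solve-∀
    cba : ∀ x y z → z ℕ.+ y ℕ.+ x ≡ x ℕ.+ y ℕ.+ z
    cba = ℕ-solve-∀
    go : ∀ a b c → a ≢ b → a ≢ c → b ≢ c → g a ℕ.+ g b ℕ.+ g c ≡ Σᴸ g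
    go fwd fwd _ p _ _ = ⊥-elim (p refl)
    go bwd bwd _ p _ _ = ⊥-elim (p refl)
    go spoke spoke _ p _ _ = ⊥-elim (p refl)
    go fwd _ fwd _ p _ = ⊥-elim (p refl)
    go bwd _ bwd _ p _ = ⊥-elim (p refl)
    go spoke _ spoke _ p _ = ⊥-elim (p refl)
    go _ fwd fwd _ _ p = ⊥-elim (p refl)
    go _ bwd bwd _ _ p = ⊥-elim (p refl)
    go _ spoke spoke _ _ p = ⊥-elim (p refl)
    go fwd bwd spoke _ _ _ = refl
    go fwd spoke bwd _ _ _ = acb x y z
    go bwd fwd spoke _ _ _ = bac x y z
    go bwd spoke fwd _ _ _ = bca x y z
    go spoke fwd bwd _ _ _ = cab x y z
    go spoke bwd fwd _ _ _ = cba x y z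

  Σᴸ-∘ : ∀ g (f : Letter → Letter) → (∀ {l m} → f l ≡ f m → l ≡ m) → Σᴸ (g ∘ f) ≡ Σᴸ g
  Σᴸ-∘ g f inj = Σᴸ-permute g (f fwd) (f bwd) (f spoke) (λ e → case₁ (inj e)) (λ e → case₂ (inj e)) (λ e → case₃ (inj e))
    where
    case₁ : fwd ≢ bwd
    case₁ ()
    case₂ : fwd ≢ spoke
    case₂ ()
    case₃ : bwd ≢ spoke
    case₃ ()

  -- Leaving out one letter amounts to subtracting one term from the full sum, and a permutation of
  -- the three letters does not change the full sum.
  Σ≠-∘ : ∀ g (f : Letter → Letter) → (∀ {l m} → f l ≡ f m → l ≡ m) → ∀ b → Σ≠ (f b) g ≡ Σ≠ b (g ∘ f)
  Σ≠-∘ g f inj b = ℕ.+-cancelˡ-≡ (g (f b)) _ _ (trans (Σ≠-complement (f b) g) (sym (trans (Σ≠-complement b (g ∘ f)) (Σᴸ-∘ g f inj))))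

  Σ≠-cong : ∀ {g h : Letter → ℕ} b → (∀ l → g l ≡ h l) → Σ≠ b g ≡ Σ≠ b h
  Σ≠-cong b e = cong₂ ℕ._+_ (e _) (e _)

  bit : Bool → ℕ
  bit b = if b then 1 else 0

  -- (a , b) stands for the shift a + b k, kept symbolic in k.
  Shift : Set
  Shift = ℤ × ℤ

  advance : Bool → Letter → Shift → Shift
  advance false fwd (a , b) = a + + 1 , b
  advance false bwd (a , b) = a - + 1 , b
  advance true fwd (a , b) = a , b + + 1
  advance true bwd (a , b) = a , b - + 1
  advance _ spoke s = s

  -- The shifts of the non-backtracking walks of r steps from an arc of kind (t , l) to one of kind (t₀ , l₀).
  closings : ℕ → Bool → Letter → Shift → Bool → Letter → List Shift
  closings zero t l s t₀ l₀ = if does (t Bool.≟ t₀) ∧ does (l ≟ᴸ l₀) then s ∷ [] else []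
  closings (suc r) t l s t₀ l₀ =
    closings r (flip t l) (proj₁ (others (back l))) (advance t l s) t₀ l₀ ++
    closings r (flip t l) (proj₂ (others (back l))) (advance t l s) t₀ l₀

  _≟ˢ_ : DecidableEquality Shift
  _≟ˢ_ = ≡-dec ℤ._≟_ ℤ._≟_


  Equitable : (Bool → Letter → ℕ) → Set
  Equitable C = C false fwd ≡ C false spoke × C true fwd ≡ C false spoke

  module Counting (ρ : Shift → Bool) where

    weigh : List Shift → ℕ
    weigh = sum ∘ map (bit ∘ ρ)

    count : ℕ → Bool → Letter → ℕ
    count r t l = weigh (closings r t l (+ 0 , + 0) t l)

  normalise : Shift → Shift
  normalise (-[1+ a ] , b) = + suc a , - b
  normalise (+ 0 , -[1+ b ]) = + 0 , + suc b
  normalise s = s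

  -- Up to sign, these are the shifts of closed non-backtracking walks of length 8; the tallies below count
  -- the walks through an outer, spoke or inner arc for each of them.
  shifts : List Shift
  shifts = (+ 0 , + 0) ∷ (+ 2 , + 0) ∷ (+ 0 , + 2) ∷ (+ 8 , + 0) ∷ (+ 0 , + 8)
    ∷ (+ 1 , + 5) ∷ (+ 1 , - + 5) ∷ (+ 2 , + 4) ∷ (+ 2 , - + 4)
    ∷ (+ 3 , + 3) ∷ (+ 3 , - + 3) ∷ (+ 4 , + 2) ∷ (+ 4 , - + 2)
    ∷ (+ 5 , + 1) ∷ (+ 5 , - + 1) ∷ (+ 2 , + 2) ∷ (+ 2 , - + 2) ∷ []

  insert : Shift → List (ℕ × Shift) → List (ℕ × Shift)
  insert s [] = (1 , s) ∷ []
  insert s ((c , s′) ∷ T) with s ≟ˢ s′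
  ... | yes _ = (suc c , s′) ∷ T
  ... | no _ = (c , s′) ∷ insert s T

  tally : List Shift → List (ℕ × Shift)
  tally = foldr (insert ∘ normalise) (map (0 ,_) shifts)

  outerTally spokeTally innerTally : List ℕ
  outerTally = 2 ∷ 2 ∷ 2 ∷ 1 ∷ 0 ∷ 1 ∷ 1 ∷ 2 ∷ 2 ∷ 3 ∷ 3 ∷ 4 ∷ 4 ∷ 5 ∷ 5 ∷ 1 ∷ 1 ∷ []
  spokeTally = 4 ∷ 4 ∷ 4 ∷ 0 ∷ 0 ∷ 2 ∷ 2 ∷ 2 ∷ 2 ∷ 2 ∷ 2 ∷ 2 ∷ 2 ∷ 2 ∷ 2 ∷ 2 ∷ 2 ∷ []
  innerTally = 2 ∷ 2 ∷ 2 ∷ 0 ∷ 1 ∷ 5 ∷ 5 ∷ 4 ∷ 4 ∷ 3 ∷ 3 ∷ 2 ∷ 2 ∷ 1 ∷ 1 ∷ 1 ∷ 1 ∷ []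

  multiplicities : Bool → Letter → List ℕ
  multiplicities _ spoke = spokeTally
  multiplicities false _ = outerTally
  multiplicities true _ = innerTally

  -- Shifts are symbolic in `k`, so one evaluation serves all `n` and `k`. Since `tally` starts from
  -- zero entries in the order of `shifts` and appends anything new, the equality also says that no
  -- other shift occurs.
  tally-closings : ∀ t l → tally (closings 8 t l (+ 0 , + 0) t l) ≡ zip (multiplicities t l) shifts
  tally-closings false fwd = refl
  tally-closings false bwd = refl
  tally-closings false spoke = refl
  tally-closings true fwd = refl
  tally-closings true bwd = refl
  tally-closings true spoke = refl

  dot : List ℕ → List Bool → ℕ
  dot (c ∷ cs) (b ∷ bs) = c ℕ.* bit b ℕ.+ dot cs bs
  dot _ _ = 0

  module _ {ρ : Shift → Bool} (ρ-normalise : ∀ s → ρ (normalise s) ≡ ρ s) where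

    open Counting ρ

    weighTally : List (ℕ × Shift) → ℕ
    weighTally [] = 0
    weighTally ((c , s) ∷ T) = c ℕ.* bit (ρ s) ℕ.+ weighTally T

    weighTally-insert : ∀ s T → weighTally (insert s T) ≡ bit (ρ s) ℕ.+ weighTally T
    weighTally-insert s [] = cong (ℕ._+ 0) (ℕ.*-identityˡ (bit (ρ s)))
    weighTally-insert s ((c , s′) ∷ T) with s ≟ˢ s′
    ... | yes refl = ℕ.+-assoc (bit (ρ s)) (c ℕ.* bit (ρ s)) (weighTally T)
    ... | no _ = trans (cong (c ℕ.* bit (ρ s′) ℕ.+_) (weighTally-insert s T)) (eq (c ℕ.* bit (ρ s′)) (bit (ρ s)) (weighTally T))
      where
      eq : ∀ x y z → x ℕ.+ (y ℕ.+ z) ≡ y ℕ.+ (x ℕ.+ z)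
      eq = ℕ-solve-∀

    weighTally-tally : ∀ L → weighTally (tally L) ≡ weigh L
    weighTally-tally [] = refl
    weighTally-tally (s ∷ L) = trans (weighTally-insert (normalise s) (tally L)) (cong₂ (λ b → bit b ℕ.+_) (ρ-normalise s) (weighTally-tally L))

    weighTally-zip : ∀ cs ss → weighTally (zip cs ss) ≡ dot cs (map ρ ss)
    weighTally-zip [] _ = refl
    weighTally-zip (_ ∷ _) [] = refl
    weighTally-zip (c ∷ cs) (s ∷ ss) = cong (c ℕ.* bit (ρ s) ℕ.+_) (weighTally-zip cs ss)

    count-8 : ∀ t l → count 8 t l ≡ dot (multiplicities t l) (map ρ shifts)
    count-8 t l = begin
      weigh L                                       ≡⟨ weighTally-tally L ⟨
      weighTally (tally L)                          ≡⟨ cong weighTally (tally-closings t l) ⟩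
      weighTally (zip (multiplicities t l) shifts)  ≡⟨ weighTally-zip (multiplicities t l) shifts ⟩
      dot (multiplicities t l) (map ρ shifts)       ∎
      where
      open ≡-Reasoning
      L = closings 8 t l (+ 0 , + 0) t l

  module Vanishing (n k : ℕ) where

    value : Shift → ℤ
    value (a , b) = a + b * + k

    vanishes : Shift → Bool
    vanishes s = does (+ n ∣? value s)

    value-neg : ∀ a b → value (- a , - b) ≡ - value (a , b)
    value-neg a b = eq a b (+ k)
      where
      eq : ∀ a b c → - a + - b * c ≡ - (a + b * c)
      eq = solve-∀

    vanishes-neg : ∀ a b → vanishes (- a , - b) ≡ vanishes (a , b)
    vanishes-neg a b = does-⇔ (mk⇔ (λ p → ∣-lin₁ (- + 1) p (trans (eq (value (a , b))) (cong (- + 1 *_) (sym (value-neg a b)))))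
      (λ p → ∣-lin₁ (- + 1) p (trans (value-neg a b) (eq′ (value (a , b)))))) (+ n ∣? value (- a , - b)) (+ n ∣? value (a , b))
      where
      eq : ∀ x → x ≡ - + 1 * - x
      eq = solve-∀
      eq′ : ∀ x → - x ≡ - + 1 * x
      eq′ = solve-∀

    vanishes-normalise : ∀ s → vanishes (normalise s) ≡ vanishes s
    vanishes-normalise (-[1+ a ] , b) = vanishes-neg -[1+ a ] b
    vanishes-normalise (+ 0 , -[1+ b ]) = vanishes-neg (+ 0) -[1+ b ]
    vanishes-normalise (+ 0 , + b) = refl
    vanishes-normalise (+ suc a , b) = refl

  -- The double cover and its symmetries

  module Petersen (n k : ℕ) {{_ : NonZero n}} (1≤k : 1 ℕ.≤ k) (2k<n : 2 ℕ.* k ℕ.< n) where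

    open Residue n
    open Vanishing n k

    2<n : 2 ℕ.< n
    2<n = ℕ.≤-<-trans (ℕ.*-monoʳ-≤ 2 1≤k) 2k<n

    GV DV : Set
    GV = Bool × Fin n
    DV = GV × Bool

    D : Graph
    D = DoubleCover (GP n k)

    stride : Bool → ℕ
    stride false = 1
    stride true = k

    1≤stride : ∀ t → 1 ℕ.≤ stride t
    1≤stride false = ℕ.≤-refl
    1≤stride true = 1≤k

    2stride<n : ∀ t → 2 ℕ.* stride t ℕ.< n
    2stride<n false = 2<n
    2stride<n true = 2k<n

    move : Bool → Letter → ℤ
    move t fwd = + stride t
    move t bwd = - + stride t
    move t spoke = + 0

    nbG : GV → Letter → GV
    nbG (t , i) l = flip t l , i ⊕ move t l

    nb : DV → Letter → DV
    nb (v , x) l = nbG v l , not x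

    move-back : ∀ t l → move t l + move (flip t l) (back l) ≡ + 0
    move-back t fwd = ℤ.+-inverseʳ (+ stride t)
    move-back t bwd = ℤ.+-inverseˡ (+ stride t)
    move-back t spoke = refl

    flip-back : ∀ t l → flip (flip t l) (back l) ≡ t
    flip-back t fwd = refl
    flip-back t bwd = refl
    flip-back t spoke = Bool.not-involutive t

    nbG-back : ∀ v l → nbG (nbG v l) (back l) ≡ v
    nbG-back (t , i) l = cong₂ _,_ (flip-back t l) (trans (⊕-assoc i (move t l) _) (⊕-zero (divides (+ 0) (move-back t l))))

    nb-back : ∀ v l → nb (nb v l) (back l) ≡ v
    nb-back (v , x) l = cong₂ _,_ (nbG-back v l) (Bool.not-involutive x)

    ∤2stride : ∀ t → ¬ (+ n ∣ + (2 ℕ.* stride t))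
    ∤2stride t = ∤-between (ℕ.<-≤-trans (1≤stride t) (ℕ.m≤m+n (stride t) _)) (2stride<n t)

    nbG-injective : ∀ v {l m} → nbG v l ≡ nbG v m → l ≡ m
    nbG-injective _ {fwd} {fwd} e = refl
    nbG-injective _ {bwd} {bwd} e = refl
    nbG-injective _ {spoke} {spoke} e = refl
    nbG-injective (t , i) {fwd} {bwd} e = ⊥-elim (∤2stride t (∣-lin₁ (+ 1) (⊕-injective (cong proj₂ e)) (trans (ℤ.pos-* 2 (stride t)) (eq (+ stride t)))))
      where
      eq : ∀ s → + 2 * s ≡ + 1 * (s - - s)
      eq = solve-∀
    nbG-injective (t , i) {bwd} {fwd} e = ⊥-elim (∤2stride t (∣-lin₁ (+ 1) (⊕-injective (cong proj₂ (sym e))) (trans (ℤ.pos-* 2 (stride t)) (eq (+ stride t)))))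
      where
      eq : ∀ s → + 2 * s ≡ + 1 * (s - - s)
      eq = solve-∀
    nbG-injective (t , i) {fwd} {spoke} e = ⊥-elim (Bool.not-¬ {t} refl (cong proj₁ e))
    nbG-injective (t , i) {bwd} {spoke} e = ⊥-elim (Bool.not-¬ {t} refl (cong proj₁ e))
    nbG-injective (t , i) {spoke} {fwd} e = ⊥-elim (Bool.not-¬ {t} refl (cong proj₁ (sym e)))
    nbG-injective (t , i) {spoke} {bwd} e = ⊥-elim (Bool.not-¬ {t} refl (cong proj₁ (sym e)))

    nb-injective : ∀ v {l m} → nb v l ≡ nb v m → l ≡ m
    nb-injective (v , _) e = nbG-injective v (cong proj₁ e)

    stride₊ : ∀ i c → (toℕ i ℕ.+ c) ≋ toℕ (i ⊕ + c) [mod n ]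
    stride₊ i c = ∣⇒≋ (∣-lin₁ (- + 1) (⊕-≈ i (+ c)) (eq (+ toℕ i + + c) (+ toℕ (i ⊕ + c))))
      where
      eq : ∀ x y → x - y ≡ - + 1 * (y - x)
      eq = solve-∀

    stride₋ : ∀ i c → (toℕ (i ⊕ - + c) ℕ.+ c) ≋ toℕ i [mod n ]
    stride₋ i c = ∣⇒≋ (∣-lin₁ (+ 1) (⊕-≈ i (- + c)) (eq (+ toℕ i) (+ c) (+ toℕ (i ⊕ - + c))))
      where
      eq : ∀ x c y → y + c - x ≡ + 1 * (y - (x + - c))
      eq = solve-∀

    ≋⇒⊕ : ∀ {i j c} → (toℕ i ℕ.+ c) ≋ toℕ j [mod n ] → i ⊕ + c ≡ j
    ≋⇒⊕ {i} {j} {c} p = trans (⊕≡⟦⟧ i (+ c)) (trans (⟦⟧-cong (≋⇒∣ p)) (⟦toℕ⟧ j))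

    ≋⇒⊖ : ∀ {i j c} → (toℕ j ℕ.+ c) ≋ toℕ i [mod n ] → i ⊕ - + c ≡ j
    ≋⇒⊖ {i} {j} {c} p = trans (⊕≡⟦⟧ i (- + c)) (trans (⟦⟧-cong (∣-lin₁ (- + 1) (≋⇒∣ p) (eq (+ toℕ i) (+ toℕ j) (+ c)))) (⟦toℕ⟧ j))
      where
      eq : ∀ x y c → (x + - c) - y ≡ - + 1 * ((y + c) - x)
      eq = solve-∀

    ⊕0 : ∀ i → i ⊕ + 0 ≡ i
    ⊕0 i = ⊕-zero (divides (+ 0) refl)

    adjG : ∀ v l → GPAdj n k v (nbG v l)
    adjG (false , i) fwd = uu₊ (stride₊ i 1)
    adjG (false , i) bwd = uu₋ (stride₋ i 1)
    adjG (true , i) fwd = vv₊ (stride₊ i k)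
    adjG (true , i) bwd = vv₋ (stride₋ i k)
    adjG (false , i) spoke = subst (λ j → GPAdj n k (false , i) (true , j)) (sym (⊕0 i)) uv
    adjG (true , i) spoke = subst (λ j → GPAdj n k (true , i) (false , j)) (sym (⊕0 i)) vu

    letterG : ∀ {v w} → GPAdj n k v w → ∃ λ l → nbG v l ≡ w
    letterG (uu₊ p) = fwd , cong (false ,_) (≋⇒⊕ p)
    letterG (uu₋ p) = bwd , cong (false ,_) (≋⇒⊖ p)
    letterG (vv₊ p) = fwd , cong (true ,_) (≋⇒⊕ p)
    letterG (vv₋ p) = bwd , cong (true ,_) (≋⇒⊖ p)
    letterG {_ , i} uv = spoke , cong (true ,_) (⊕0 i)
    letterG {_ , i} vu = spoke , cong (false ,_) (⊕0 i)

    adjD : ∀ v l → Adj D v (nb v l)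
    adjD (v , x) l = adjG v l , Bool.not-¬ refl

    letterD : ∀ {v w} → Adj D v w → ∃ λ l → nb v l ≡ w
    letterD {_ , x} {_ , y} (a , x≢y) with letterG a
    ... | l , refl = l , cong (_ ,_) (sym (Bool.¬-not (x≢y ∘ sym)))

    -- The action of an automorphism on arcs: the arc l at v goes to the arc turn v l at map v.
    record Symmetry : Set where
      field
        image : DV → DV
        injective : ∀ {v w} → image v ≡ image w → v ≡ w
        turn : DV → Letter → Letter
        turn-surjective : ∀ v l → ∃ λ m → turn v m ≡ l
        nb-image : ∀ v l → nb (image v) (turn v l) ≡ image (nb v l)

      turn-injective : ∀ v {l m} → turn v l ≡ turn v m → l ≡ m
      turn-injective v {l} {m} e = nb-injective v (injective (trans (sym (nb-image v l)) (trans (cong (nb (image v)) e) (nb-image v m))))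

      turn-back : ∀ v l → turn (nb v l) (back l) ≡ back (turn v l)
      turn-back v l = nb-injective (image (nb v l)) (begin
        nb (image (nb v l)) (turn (nb v l) (back l))      ≡⟨ nb-image (nb v l) (back l) ⟩
        image (nb (nb v l) (back l))                      ≡⟨ cong image (nb-back v l) ⟩
        image v                                           ≡⟨ nb-back (image v) (turn v l) ⟨
        nb (nb (image v) (turn v l)) (back (turn v l))    ≡⟨ cong (λ w → nb w (back (turn v l))) (nb-image v l) ⟩
        nb (image (nb v l)) (back (turn v l))             ∎)
        where open ≡-Reasoning

    symmetry : Aut D → Symmetry
    symmetry φ = record
      { image = fun φ
      ; injective = λ {v} {w} e → trans (sym (inv-left φ v)) (trans (cong (inv φ) e) (inv-left φ w))
      ; turn = λ v l → proj₁ (arc v l)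
      ; turn-surjective = arc⁻¹
      ; nb-image = λ v l → proj₂ (arc v l)
      }
      where
      arc : ∀ v l → ∃ λ m → nb (fun φ v) m ≡ fun φ (nb v l)
      arc v l = letterD (Equivalence.to (adj φ v (nb v l)) (adjD v l))
      arc⁻¹ : ∀ v l → ∃ λ m → proj₁ (arc v m) ≡ l
      arc⁻¹ v l with letterD (Equivalence.from (adj φ v (inv φ (nb (fun φ v) l)))
                              (subst (Adj D (fun φ v)) (sym (inv-right φ _)) (adjD (fun φ v) l)))
      ... | m , e = m , nb-injective (fun φ v) (trans (proj₂ (arc v m)) (trans (cong (fun φ) e) (inv-right φ _)))

    _≟ᴰ_ : DecidableEquality DV
    _≟ᴰ_ = ≡-dec (≡-dec Bool._≟_ Fin._≟_) Bool._≟_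

    same : DV → Letter → DV → Letter → Bool
    same v l w m = does (v ≟ᴰ w ×-dec l ≟ᴸ m)

    walks : ℕ → DV → Letter → DV → Letter → ℕ
    walks zero v l w m = bit (same v l w m)
    walks (suc r) v l w m = Σ≠ (back l) (λ l′ → walks r (nb v l) l′ w m)

    module _ (σ : Symmetry) where
      open Symmetry σ

      -- By `turn-back` the letter excluded after a step is carried to the excluded letter at the
      -- image, and `turn` permutes the other two; hence non-backtracking walks go to
      -- non-backtracking walks.
      walks-image : ∀ r v l w m → walks r (image v) (turn v l) (image w) (turn w m) ≡ walks r v l w m
      walks-image zero v l w m = cong bit (does-⇔ (mk⇔ to from) (image v ≟ᴰ image w ×-dec turn v l ≟ᴸ turn w m) (v ≟ᴰ w ×-dec l ≟ᴸ m))
        where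
        to : image v ≡ image w × turn v l ≡ turn w m → v ≡ w × l ≡ m
        to (e , e′) with injective e
        ... | refl = refl , turn-injective v e′
        from : v ≡ w × l ≡ m → image v ≡ image w × turn v l ≡ turn w m
        from (refl , refl) = refl , refl
      walks-image (suc r) v l w m = begin
        Σ≠ (back (turn v l)) (λ l′ → walks r (nb (image v) (turn v l)) l′ W M)   ≡⟨ cong₂ (λ b u → Σ≠ b (λ l′ → walks r u l′ W M)) (turn-back v l) (sym (nb-image v l)) ⟨
        Σ≠ (turn v′ (back l)) (λ l′ → walks r (image v′) l′ W M)                 ≡⟨ Σ≠-∘ (λ l′ → walks r (image v′) l′ W M) (turn v′) (turn-injective v′) (back l) ⟩
        Σ≠ (back l) (λ l′ → walks r (image v′) (turn v′ l′) W M)                 ≡⟨ Σ≠-cong (back l) (λ l′ → walks-image r v′ l′ w m) ⟩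
        Σ≠ (back l) (λ l′ → walks r v′ l′ w m)                                   ∎
        where
        open ≡-Reasoning
        v′ = nb v l
        W = image w
        M = turn w m

    open Counting vanishes

    value-advance : ∀ t l s → value (advance t l s) ≡ value s + move t l
    value-advance false fwd (a , b) = eq a (b * + k)
      where
      eq : ∀ x y → x + + 1 + y ≡ x + y + + 1
      eq = solve-∀
    value-advance false bwd (a , b) = eq a (b * + k)
      where
      eq : ∀ x y → x - + 1 + y ≡ x + y + - + 1
      eq = solve-∀
    value-advance true fwd (a , b) = eq a b (+ k)
      where
      eq : ∀ x y z → x + (y + + 1) * z ≡ x + y * z + z
      eq = solve-∀
    value-advance true bwd (a , b) = eq a b (+ k)
      where
      eq : ∀ x y z → x + (y - + 1) * z ≡ x + y * z + - z
      eq = solve-∀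
    value-advance false spoke s = sym (ℤ.+-identityʳ (value s))
    value-advance true spoke s = sym (ℤ.+-identityʳ (value s))

    not^ : ℕ → Bool → Bool
    not^ zero x = x
    not^ (suc r) x = not^ r (not x)

    weigh-++ : ∀ L M → weigh (L ++ M) ≡ weigh L ℕ.+ weigh M
    weigh-++ L M = trans (cong sum (map-++ (bit ∘ vanishes) L M)) (sum-++ (map (bit ∘ vanishes) L) _)

    -- The induction needs walks that are already under way: the accumulated shift `s` is put into
    -- the starting vertex while the target keeps the index `i`. The walk closes exactly when the
    -- final shift vanishes modulo `n`.
    walks-closings : ∀ r t i x l s t₀ l₀ →
      walks r ((t , i ⊕ value s) , x) l ((t₀ , i) , not^ r x) l₀ ≡ weigh (closings r t l s t₀ l₀)
    walks-closings zero t i x l s t₀ l₀ = go (t Bool.≟ t₀) (l ≟ᴸ l₀)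
      where
      at : Dec (((t , i ⊕ value s) , x) ≡ ((t₀ , i) , x) × l ≡ l₀)
      at = ((t , i ⊕ value s) , x) ≟ᴰ ((t₀ , i) , x) ×-dec l ≟ᴸ l₀
      go : (p : Dec (t ≡ t₀)) (q : Dec (l ≡ l₀)) →
        bit (does at) ≡ weigh (if does p ∧ does q then s ∷ [] else [])
      go (no t≢) _ = cong bit (dec-false at (λ e → t≢ (cong (proj₁ ∘ proj₁) (proj₁ e))))
      go (yes _) (no l≢) = cong bit (dec-false at (l≢ ∘ proj₂))
      go (yes refl) (yes refl) = trans (cong bit (does-⇔ (mk⇔
        (λ e → ⊕-fixed (cong (proj₂ ∘ proj₁) (proj₁ e)))
        (λ p → cong (λ j → (t , j) , x) (⊕-zero p) , refl)) at (+ n ∣? value s))) (sym (ℕ.+-identityʳ _))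
    walks-closings (suc r) t i x l s t₀ l₀ = begin
      Σ≠ (back l) (λ l′ → walks r (nb ((t , i ⊕ value s) , x) l) l′ w l₀)   ≡⟨ Σ≠-cong (back l) shift ⟩
      Σ≠ (back l) (λ l′ → weigh (closings r (flip t l) l′ (advance t l s) t₀ l₀))  ≡⟨ weigh-++ (closings r (flip t l) (proj₁ (others (back l))) (advance t l s) t₀ l₀) _ ⟨
      weigh (closings (suc r) t l s t₀ l₀)                                  ∎
      where
      open ≡-Reasoning
      w = (t₀ , i) , not^ (suc r) x
      shift : ∀ l′ → walks r (nb ((t , i ⊕ value s) , x) l) l′ w l₀ ≡ weigh (closings r (flip t l) l′ (advance t l s) t₀ l₀)
      shift l′ = trans (cong (λ j → walks r ((flip t l , j) , not x) l′ w l₀) (trans (⊕-assoc i (value s) (move t l)) (cong (i ⊕_) (sym (value-advance t l s)))))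
        (walks-closings r (flip t l) i (not x) l′ (advance t l s) t₀ l₀)

    -- The hypothesis says that the layer is restored, so closed walks of the graph lift to closed
    -- walks of the double cover. It is met by even lengths.
    walks-count : ∀ r v l → not^ r (proj₂ v) ≡ proj₂ v → walks r v l v l ≡ count r (proj₁ (proj₁ v)) l
    walks-count r ((t , i) , x) l e = trans
      (cong₂ (λ j y → walks r ((t , j) , x) l ((t , i) , y) l) (sym (⊕-zero (divides (+ 0) refl))) (sym e))
      (walks-closings r t i x l (+ 0 , + 0) t l)

    module ArcCounts (C : Bool → Letter → ℕ)
      (C-bwd : ∀ t → C t bwd ≡ C t fwd) (C-spoke : C true spoke ≡ C false spoke)
      (σ : Symmetry)
      (C-turn : ∀ v l → C (proj₁ (proj₁ (Symmetry.image σ v))) (Symmetry.turn σ v l) ≡ C (proj₁ (proj₁ v)) l) where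

      open Symmetry σ

      type : DV → Bool
      type v = proj₁ (proj₁ v)

      Σ-type : ∀ v → Σᴸ (C (type (image v))) ≡ Σᴸ (C (type v))
      Σ-type v = trans (sym (Σᴸ-∘ (C (type (image v))) (turn v) (turn-injective v)))
        (cong₂ ℕ._+_ (cong₂ ℕ._+_ (C-turn v fwd) (C-turn v bwd)) (C-turn v spoke))

      cancel : Σᴸ (C true) ≡ Σᴸ (C false) → C true fwd ≡ C false fwd
      cancel e = ℕ.*-cancelˡ-≡ _ _ 2 (ℕ.+-cancelʳ-≡ (C false spoke) _ _ (begin
        2 ℕ.* C true fwd ℕ.+ C false spoke             ≡⟨ eq (C true fwd) (C false spoke) ⟩
        C true fwd ℕ.+ C true fwd ℕ.+ C false spoke    ≡⟨ cong₂ (λ y z → C true fwd ℕ.+ y ℕ.+ z) (C-bwd true) C-spoke ⟨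
        Σᴸ (C true)                                    ≡⟨ e ⟩
        Σᴸ (C false)                                   ≡⟨ cong (λ y → C false fwd ℕ.+ y ℕ.+ C false spoke) (C-bwd false) ⟩
        C false fwd ℕ.+ C false fwd ℕ.+ C false spoke  ≡⟨ eq (C false fwd) (C false spoke) ⟨
        2 ℕ.* C false fwd ℕ.+ C false spoke            ∎))
        where
        open ≡-Reasoning
        eq : ∀ x y → 2 ℕ.* x ℕ.+ y ≡ x ℕ.+ x ℕ.+ y
        eq = ℕ-solve-∀

      -- If the spoke at `v` goes to a rim arc, then both ends of that arc lie on the same rim,
      -- whereas the ends of the spoke lie on different ones. The total over the three arcs at a
      -- vertex is invariant, so it agrees for outer and inner vertices. Spoke arcs contribute
      -- equally to both totals, so outer and inner arcs have equal weight too, and the rim arc hit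
      -- has the weight of a spoke.
      equitable : ∀ v → type v ≡ false → turn v spoke ≢ spoke → Equitable C
      equitable v@((false , _) , _) refl s≢ = go (image v) refl (turn v spoke) refl
        where
        Σs : ∀ w → nb (image v) (turn v spoke) ≡ w → Σᴸ (C (type w)) ≡ Σᴸ (C true)
        Σs w refl = trans (cong (Σᴸ ∘ C ∘ type) (nb-image v spoke)) (Σ-type (nb v spoke))
        finish : ∀ t → C t fwd ≡ C false spoke → Σᴸ (C t) ≡ Σᴸ (C true) → Σᴸ (C t) ≡ Σᴸ (C false) → Equitable C
        finish false p q _ = p , trans (cancel (sym q)) p
        finish true p _ q = trans (sym (cancel q)) p , p
        go : ∀ w → image v ≡ w → ∀ l → turn v spoke ≡ l → Equitable C
        go w e spoke e′ = ⊥-elim (s≢ e′)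
        go w@((t , _) , _) e fwd e′ = finish t (trans (cong₂ (λ u l → C (type u) l) (sym e) (sym e′)) (C-turn v spoke))
            (Σs (nb w fwd) (cong₂ nb e e′)) (trans (cong (Σᴸ ∘ C ∘ type) (sym e)) (Σ-type v))
        go w@((t , _) , _) e bwd e′ = finish t (trans (sym (C-bwd t)) (trans (cong₂ (λ u l → C (type u) l) (sym e) (sym e′)) (C-turn v spoke)))
            (Σs (nb w bwd) (cong₂ nb e e′)) (trans (cong (Σᴸ ∘ C ∘ type) (sym e)) (Σ-type v))

  -- Arithmetic of equal walk counts

  ∀ᵇ? : ∀ {P : Bool → Set} → (∀ b → Dec (P b)) → Dec (∀ b → P b)
  ∀ᵇ? P? = map′ (λ { (p , q) false → p ; (p , q) true → q }) (λ p → p false , p true) (P? false ×-dec P? true)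

  infix 4 _≋?_[mod_]
  _≋?_[mod_] : ∀ a b m → Dec (a ≋ b [mod m ])
  a ≋? b [mod m ] = map′ ∣⇒≋ ≋⇒∣ (+ m ∣? + a - + b)

  -- For odd `n` the quotient `n / 2` is rounded down and the congruences lose their meaning, which
  -- is why `Small` and `commutes` pair this condition with `2 ∣ n`.
  Exceptional : ℕ → ℕ → Set
  Exceptional n k = (k ℕ.* k ≋ 1 [mod n ℕ./ 2 ]) ⊎ (k ℕ.* k ℕ.+ 1 ≋ 0 [mod n ℕ./ 2 ]) ⊎ (n ≡ 4 ℕ.* k)

  exceptional? : ∀ n k → Dec (Exceptional n k)
  exceptional? n k = (k ℕ.* k ≋? 1 [mod n ℕ./ 2 ]) ⊎-dec (k ℕ.* k ℕ.+ 1 ≋? 0 [mod n ℕ./ 2 ]) ⊎-dec (n ℕ.≟ 4 ℕ.* k)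

  record EquitableTallies (bs : List Bool) : Set where
    constructor equitable
    field
      outer≡spoke : dot outerTally bs ≡ dot spokeTally bs
      inner≡spoke : dot innerTally bs ≡ dot spokeTally bs

  equitableTallies? : ∀ bs → Dec (EquitableTallies bs)
  equitableTallies? bs = map′ (λ (p , q) → equitable p q) (λ (equitable p q) → p , q)
    ((dot outerTally bs ℕ.≟ dot spokeTally bs) ×-dec (dot innerTally bs ℕ.≟ dot spokeTally bs))

  Both Either : Bool → Bool → Set
  Both b c = b ≡ true × c ≡ true
  Either b c = b ≡ true ⊎ c ≡ true

  both? : ∀ b c → Dec (Both b c)
  both? b c = (b Bool.≟ true) ×-dec (c Bool.≟ true)

  either? : ∀ b c → Dec (Either b c)
  either? b c = (b Bool.≟ true) ⊎-dec (c Bool.≟ true)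

  -- The arguments tell which of the shifts vanish modulo n, p for a + b k and m for a - b k.
  opaque
    oddSolutions : ∀ p₁₅ m₁₅ p₂₄ m₂₄ p₃₃ m₃₃ p₄₂ m₄₂ p₅₁ m₅₁ p₂₂ m₂₂ →
      EquitableTallies (true ∷ false ∷ false ∷ false ∷ false ∷ p₁₅ ∷ m₁₅ ∷ p₂₄ ∷ m₂₄ ∷ p₃₃ ∷ m₃₃ ∷ p₄₂ ∷ m₄₂ ∷ p₅₁ ∷ m₅₁ ∷ p₂₂ ∷ m₂₂ ∷ []) →
      Both p₁₅ m₁₅ ⊎ Both p₂₄ m₂₄ ⊎ Both p₃₃ m₃₃ ⊎ Both p₄₂ m₄₂ ⊎ Both p₅₁ m₅₁ ⊎ Both p₂₂ m₂₂
        ⊎ (Either p₄₂ m₄₂ × Either p₂₄ m₂₄) ⊎ (Either p₅₁ m₅₁ × Either p₁₅ m₁₅)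
        ⊎ (Either p₄₂ m₄₂ × Either p₂₂ m₂₂) ⊎ (Either p₅₁ m₅₁ × Either p₂₂ m₂₂)
    oddSolutions = from-yes (∀ᵇ? λ a → ∀ᵇ? λ b → ∀ᵇ? λ c → ∀ᵇ? λ d → ∀ᵇ? λ e → ∀ᵇ? λ f →
      ∀ᵇ? λ g → ∀ᵇ? λ h → ∀ᵇ? λ i → ∀ᵇ? λ j → ∀ᵇ? λ k → ∀ᵇ? λ l →
      equitableTallies? (true ∷ false ∷ false ∷ false ∷ false ∷ a ∷ b ∷ c ∷ d ∷ e ∷ f ∷ g ∷ h ∷ i ∷ j ∷ k ∷ l ∷ []) →-dec
      (both? a b ⊎-dec both? c d ⊎-dec both? e f ⊎-dec both? g h ⊎-dec both? i j ⊎-dec both? k l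
        ⊎-dec (either? g h ×-dec either? c d) ⊎-dec (either? i j ×-dec either? a b)
        ⊎-dec (either? g h ×-dec either? k l) ⊎-dec (either? i j ×-dec either? k l)))

    evenSolutions : ∀ d₈₀ d₀₈ p₂₄ m₂₄ p₄₂ m₄₂ p₂₂ m₂₂ →
      EquitableTallies (true ∷ false ∷ false ∷ d₈₀ ∷ d₀₈ ∷ false ∷ false ∷ p₂₄ ∷ m₂₄ ∷ false ∷ false ∷ p₄₂ ∷ m₄₂ ∷ false ∷ false ∷ p₂₂ ∷ m₂₂ ∷ []) →
      d₈₀ ≡ true ⊎ Both p₂₂ m₂₂ ⊎ (Either p₄₂ m₄₂ × Either p₂₄ m₂₄)
    evenSolutions = from-yes (∀ᵇ? λ a → ∀ᵇ? λ b → ∀ᵇ? λ c → ∀ᵇ? λ d → ∀ᵇ? λ g → ∀ᵇ? λ h → ∀ᵇ? λ k → ∀ᵇ? λ l →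
      equitableTallies? (true ∷ false ∷ false ∷ a ∷ b ∷ false ∷ false ∷ c ∷ d ∷ false ∷ false ∷ g ∷ h ∷ false ∷ false ∷ k ∷ l ∷ []) →-dec
      ((a Bool.≟ true) ⊎-dec both? k l ⊎-dec (either? g h ×-dec either? c d)))

  -- What the finite search may leave over: two stable graphs that need an argument of their own,
  -- and pairs that the theorem lists as exceptions.
  Small : ℕ → ℕ → Set
  Small n k = 1 ℕ.≤ k → 2 ℕ.* k ℕ.< n → (2 ℕ.∣ n → 2 ℕ.∣ k) →
    EquitableTallies (map (Vanishing.vanishes n k) shifts) →
    (n ≡ 5 × k ≡ 2) ⊎ (n ≡ 13 × k ≡ 5) ⊎ (2 ℕ.∣ n × Exceptional n k)

  small-cases? : ∀ n k → Dec (Small n k)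
  small-cases? n k = (1 ℕ.≤? k) →-dec (2 ℕ.* k ℕ.<? n) →-dec ((2 ℕ.∣? n) →-dec (2 ℕ.∣? k)) →-dec
    equitableTallies? (map (Vanishing.vanishes n k) shifts) →-dec
    (((n ℕ.≟ 5) ×-dec (k ℕ.≟ 2)) ⊎-dec ((n ℕ.≟ 13) ×-dec (k ℕ.≟ 5)) ⊎-dec ((2 ℕ.∣? n) ×-dec exceptional? n k))

  opaque
    -- The walk counts bound `n` by 60, and `2 k < n` then puts `k` below 30.
    small-cases : ∀ {n} → n ℕ.< 61 → ∀ {k} → k ℕ.< 30 → Small n k
    small-cases = from-yes (ℕ.allUpTo? (λ n → ℕ.allUpTo? (small-cases? n) 30) 61)

  ¬2∣⇒coprime : ∀ {n} → ¬ (2 ℕ.∣ n) → Coprime n 2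
  ¬2∣⇒coprime ¬2∣n {0} (_ , 0∣2) = ⊥-elim (from-no (0 ℕ.∣? 2) 0∣2)
  ¬2∣⇒coprime ¬2∣n {1} _ = refl
  ¬2∣⇒coprime ¬2∣n {2} (2∣n , _) = ⊥-elim (¬2∣n 2∣n)
  ¬2∣⇒coprime ¬2∣n {suc (suc (suc d))} (_ , d∣2) = ⊥-elim (ℕ.<⇒≱ (s≤s (s≤s (s≤s z≤n))) (ℕ.∣⇒≤ d∣2))

  cancel-2^ : ∀ {n} → ¬ (2 ℕ.∣ n) → ∀ r {m} → n ℕ.∣ 2 ℕ.^ r ℕ.* m → n ℕ.∣ m
  cancel-2^ ¬2∣n zero {m} p = subst (_ ℕ.∣_) (ℕ.+-identityʳ m) p
  cancel-2^ {n} ¬2∣n (suc r) {m} p = cancel-2^ ¬2∣n r (coprime-divisor (¬2∣⇒coprime ¬2∣n) (subst (n ℕ.∣_) (ℕ.*-assoc 2 (2 ℕ.^ r) m) p))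

  module Vanished (n k : ℕ) where

    open Vanishing n k

    vanishes⇒∣ : ∀ s → vanishes s ≡ true → + n ∣ value s
    vanishes⇒∣ s e = toWitness {a? = + n ∣? value s} (subst T (sym (trans (isYes≗does (+ n ∣? value s)) e)) tt)

    both-∣ : ∀ a b → Both (vanishes (a , b)) (vanishes (a , - b)) → + n ∣ a + a
    both-∣ a b (p , m) = ∣-lin₂ (+ 1) (+ 1) (vanishes⇒∣ (a , b) p) (vanishes⇒∣ (a , - b) m) (eq a b (+ k))
      where
      eq : ∀ a b k → a + a ≡ + 1 * (a + b * k) + + 1 * (a + - b * k)
      eq = solve-∀

    -- Multiplying by the conjugate a - b k or a + b k removes the dependence on the sign, so both
    -- alternatives yield the same relation between `n` and k².
    either-∣ : ∀ a b → Either (vanishes (a , b)) (vanishes (a , - b)) → + n ∣ a * a - b * b * (+ k * + k)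
    either-∣ a b (inj₁ p) = ∣-lin₁ (a - b * + k) (vanishes⇒∣ (a , b) p) (eq a b (+ k))
      where
      eq : ∀ a b k → a * a - b * b * (k * k) ≡ (a - b * k) * (a + b * k)
      eq = solve-∀
    either-∣ a b (inj₂ p) = ∣-lin₁ (a + b * + k) (vanishes⇒∣ (a , - b) p) (eq a b (+ k))
      where
      eq : ∀ a b k → a * a - b * b * (k * k) ≡ (a + b * k) * (a + - b * k)
      eq = solve-∀

    -- The multipliers u and v are chosen to eliminate k².
    eliminate : ∀ {a b c d} u v → u * (b * b) ≡ v * (d * d) →
      Either (vanishes (a , b)) (vanishes (a , - b)) → Either (vanishes (c , d)) (vanishes (c , - d)) →
      + n ∣ u * (a * a) - v * (c * c)
    eliminate {a} {b} {c} {d} u v e p q = ∣-lin₂ u (- v) (either-∣ a b p) (either-∣ c d q)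
      (trans (eq (u * (a * a)) (v * (c * c)) (v * (d * d) * K))
        (trans (cong (λ z → u * (a * a) - z * K + (- (v * (c * c)) + v * (d * d) * K)) (sym e)) (eq′ a b c d u v K)))
      where
      K = + k * + k
      eq : ∀ x y z → x - y ≡ x - z + (- y + z)
      eq = solve-∀
      eq′ : ∀ a b c d u v K → u * (a * a) - u * (b * b) * K + (- (v * (c * c)) + v * (d * d) * K) ≡ u * (a * a - b * b * K) + - v * (c * c - d * d * K)
      eq′ = solve-∀

  -- Spokes are preserved outside finitely many cases

  module SpokePreservation (n k : ℕ) {{_ : NonZero n}} (1≤k : 1 ℕ.≤ k) (2k<n : 2 ℕ.* k ℕ.< n) where

    open Residue n
    open Vanishing n k
    open Vanished n k
    open Counting vanishes
    open Petersen n k 1≤k 2k<n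

    Spoked : Symmetry → Set
    Spoked σ = ∀ v → Symmetry.turn σ v spoke ≡ spoke

    count-turn : ∀ r → (∀ x → not^ r x ≡ x) → ∀ σ → let open Symmetry σ in
      ∀ v l → count r (proj₁ (proj₁ (image v))) (turn v l) ≡ count r (proj₁ (proj₁ v)) l
    count-turn r even-r σ v l = begin
      count r (proj₁ (proj₁ (image v))) (turn v l)          ≡⟨ walks-count r (image v) (turn v l) (even-r _) ⟨
      walks r (image v) (turn v l) (image v) (turn v l)     ≡⟨ walks-image σ r v l v l ⟩
      walks r v l v l                                       ≡⟨ walks-count r v l (even-r _) ⟩
      count r (proj₁ (proj₁ v)) l                           ∎
      where
      open ≡-Reasoning
      open Symmetry σ

    -- The length is a parameter because the pair (13,5) requires 10 instead of 8.
    spoked-or-equitable : ∀ r → (∀ x → not^ r x ≡ x) →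
      (∀ t → count r t bwd ≡ count r t fwd) → count r true spoke ≡ count r false spoke →
      ¬ Equitable (count r) → ∀ σ → Spoked σ
    spoked-or-equitable r even-r C-bwd C-spoke ¬E σ = spoked
      where
      open Symmetry σ
      outer : ∀ v → proj₁ (proj₁ v) ≡ false → turn v spoke ≡ spoke
      outer v e with turn v spoke ≟ᴸ spoke
      ... | yes p = p
      ... | no ¬p = ⊥-elim (¬E (ArcCounts.equitable (count r) C-bwd C-spoke σ (count-turn r even-r σ) v e ¬p))
      spoked : Spoked σ
      spoked v@((false , _) , _) = outer v refl
      -- The spoke at an inner vertex is the reverse of the spoke at its outer end, and `turn-back`
      -- transfers the result.
      spoked v@((true , _) , _) = begin
        turn v spoke                       ≡⟨ cong (λ w → turn w spoke) (nb-back v spoke) ⟨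
        turn (nb (nb v spoke) spoke) spoke ≡⟨ turn-back (nb v spoke) spoke ⟩
        back (turn (nb v spoke) spoke)     ≡⟨ cong back (outer (nb v spoke) refl) ⟩
        spoke                              ∎
        where open ≡-Reasoning

    count-8′ : ∀ t l → count 8 t l ≡ dot (multiplicities t l) (map vanishes shifts)
    count-8′ = count-8 vanishes-normalise

    equitable⇒tallies : Equitable (count 8) → EquitableTallies (map vanishes shifts)
    equitable⇒tallies (p , q) = equitable
      (trans (sym (count-8′ false fwd)) (trans p (count-8′ false spoke)))
      (trans (sym (count-8′ true fwd)) (trans q (count-8′ false spoke)))

    even-8 : ∀ x → not^ 8 x ≡ x
    even-8 false = refl
    even-8 true = refl

    spoked-8 : ¬ EquitableTallies (map vanishes shifts) → ∀ σ → Spoked σ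
    spoked-8 ¬E = spoked-or-equitable 8 even-8
      (λ { false → trans (count-8′ false bwd) (sym (count-8′ false fwd))
         ; true → trans (count-8′ true bwd) (sym (count-8′ true fwd)) })
      (trans (count-8′ true spoke) (sym (count-8′ false spoke)))
      (¬E ∘ equitable⇒tallies)

    bound : ∀ {c} → + n ∣ + suc c → suc c ℕ.≤ 60 → n ℕ.< 61
    bound p c≤ = s≤s (ℕ.≤-trans (ℕ.∣⇒≤ (∣⇒∣ᵤ p)) c≤)

    false-at : ∀ s → ¬ (+ n ∣ value s) → vanishes s ≡ false
    false-at s = dec-false (+ n ∣? value s)

    zero-shift : vanishes (+ 0 , + 0) ≡ true
    zero-shift = dec-true (+ n ∣? value (+ 0 , + 0)) (divides (+ 0) refl)

    value-constant : ∀ a → value (a , + 0) ≡ a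
    value-constant a = ℤ.+-identityʳ a

    value-multiple : ∀ b → value (+ 0 , + b) ≡ + (b ℕ.* k)
    value-multiple b = trans (ℤ.+-identityˡ (+ b * + k)) (sym (ℤ.pos-* b k))

    ∤2 : ¬ (+ n ∣ value (+ 2 , + 0))
    ∤2 p = ∤2stride false (subst (+ n ∣_) (value-constant (+ 2)) p)

    ∤2k : ¬ (+ n ∣ value (+ 0 , + 2))
    ∤2k p = ∤2stride true (subst (+ n ∣_) (value-multiple 2) p)

    ≤60 : ∀ {m} {_ : T (m ℕ.≤ᵇ 60)} → m ℕ.≤ 60
    ≤60 {m} {p} = ℕ.≤ᵇ⇒≤ m 60 p

    -- The shifts 2 and 2k never vanish because 2k < n. For odd `n` powers of 2 can be cancelled, so
    -- 8 and 8k do not vanish either. Each solution for the remaining shifts contains two relations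
    -- from which `k` can be eliminated.
    tallies⇒bound-odd : ¬ (2 ℕ.∣ n) → EquitableTallies (map vanishes shifts) → n ℕ.< 61
    tallies⇒bound-odd ¬2∣n E = go (oddSolutions _ _ _ _ _ _ _ _ _ _ _ _ (subst EquitableTallies
      (cong₂ _∷_ zero-shift (cong₂ _∷_ (false-at (+ 2 , + 0) ∤2) (cong₂ _∷_ (false-at (+ 0 , + 2) ∤2k)
        (cong₂ _∷_ (false-at (+ 8 , + 0) ∤8) (cong₂ _∷_ (false-at (+ 0 , + 8) ∤8k) refl))))) E))
      where
      ∤8 : ¬ (+ n ∣ value (+ 8 , + 0))
      ∤8 p = ∤2 (∣ᵤ⇒∣ (ℕ.∣-trans (cancel-2^ ¬2∣n 3 {1} (∣⇒∣ᵤ (subst (+ n ∣_) (value-constant (+ 8)) p))) (ℕ.1∣ 2)))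
      ∤8k : ¬ (+ n ∣ value (+ 0 , + 8))
      ∤8k p = ∤2k (subst (+ n ∣_) (sym (value-multiple 2)) (∣ᵤ⇒∣ (ℕ.∣n⇒∣m*n 2 (cancel-2^ ¬2∣n 3 {k} (∣⇒∣ᵤ (subst (+ n ∣_) (value-multiple 8) p))))))
      go : _ → n ℕ.< 61
      go (inj₁ b) = bound (both-∣ (+ 1) (+ 5) b) ≤60
      go (inj₂ (inj₁ b)) = bound (both-∣ (+ 2) (+ 4) b) ≤60
      go (inj₂ (inj₂ (inj₁ b))) = bound (both-∣ (+ 3) (+ 3) b) ≤60
      go (inj₂ (inj₂ (inj₂ (inj₁ b)))) = bound (both-∣ (+ 4) (+ 2) b) ≤60
      go (inj₂ (inj₂ (inj₂ (inj₂ (inj₁ b))))) = bound (both-∣ (+ 5) (+ 1) b) ≤60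
      go (inj₂ (inj₂ (inj₂ (inj₂ (inj₂ (inj₁ b)))))) = bound (both-∣ (+ 2) (+ 2) b) ≤60
      go (inj₂ (inj₂ (inj₂ (inj₂ (inj₂ (inj₂ (inj₁ (p , q)))))))) =
        -- 4 · 4² - 2² = 60: this case determines the bound.
        bound (eliminate {+ 4} {+ 2} {+ 2} {+ 4} (+ 4) (+ 1) refl p q) ≤60
      go (inj₂ (inj₂ (inj₂ (inj₂ (inj₂ (inj₂ (inj₂ (inj₁ (p , q))))))))) =
        -- 25 · 5² - 1² = 624 = 2⁴ · 39, and `n` is odd. The argument 38 stands for 39 because
        -- `bound` takes a predecessor.
        bound {38} (∣ᵤ⇒∣ (cancel-2^ ¬2∣n 4 {39} (∣⇒∣ᵤ (eliminate {+ 5} {+ 1} {+ 1} {+ 5} (+ 25) (+ 1) refl p q)))) ≤60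
      go (inj₂ (inj₂ (inj₂ (inj₂ (inj₂ (inj₂ (inj₂ (inj₂ (inj₁ (p , q)))))))))) =
        bound (eliminate {+ 4} {+ 2} {+ 2} {+ 2} (+ 1) (+ 1) refl p q) ≤60
      go (inj₂ (inj₂ (inj₂ (inj₂ (inj₂ (inj₂ (inj₂ (inj₂ (inj₂ (p , q)))))))))) =
        -- 4 · 5² - 2² = 96 = 2⁵ · 3, so an odd `n` divides 3.
        bound {2} (∣ᵤ⇒∣ (cancel-2^ ¬2∣n 5 {3} (∣⇒∣ᵤ (eliminate {+ 5} {+ 1} {+ 2} {+ 2} (+ 4) (+ 1) refl p q)))) ≤60

    -- With `n` and `k` even, a + b k cannot vanish for odd a. This removes six of the shifts, which
    -- compensates for the loss of the cancellation of powers of 2: the shifts 8 and 8k stay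
    -- undetermined here.
    tallies⇒bound-even : 2 ℕ.∣ n → 2 ℕ.∣ k → EquitableTallies (map vanishes shifts) → n ℕ.< 61
    tallies⇒bound-even 2∣n 2∣k E = go (evenSolutions _ _ _ _ _ _ _ _ (subst EquitableTallies
      (cong₂ _∷_ zero-shift (cong₂ _∷_ (false-at (+ 2 , + 0) ∤2) (cong₂ _∷_ (false-at (+ 0 , + 2) ∤2k)
        (cong₂ _∷_ refl (cong₂ _∷_ refl
        (cong₂ _∷_ (odd-shift 1 (+ 5)) (cong₂ _∷_ (odd-shift 1 (- + 5)) (cong₂ _∷_ refl (cong₂ _∷_ refl
        (cong₂ _∷_ (odd-shift 3 (+ 3)) (cong₂ _∷_ (odd-shift 3 (- + 3)) (cong₂ _∷_ refl (cong₂ _∷_ refl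
        (cong₂ _∷_ (odd-shift 5 (+ 1)) (cong₂ _∷_ (odd-shift 5 (- + 1)) refl))))))))))))))) E))
      where
      odd-shift : ∀ a {_ : False (+ 2 ∣? + a)} b → vanishes (+ a , b) ≡ false
      odd-shift a {¬2∣a} b = false-at (+ a , b) (λ p → toWitnessFalse {a? = + 2 ∣? + a} ¬2∣a
        (∣-lin₂ (+ 1) (- b) (∣-trans (∣ᵤ⇒∣ 2∣n) p) (∣ᵤ⇒∣ 2∣k) (eq (+ a) b (+ k))))
        where
        eq : ∀ a b k → a ≡ + 1 * (a + b * k) + - b * k
        eq = solve-∀
      go : _ → n ℕ.< 61
      go (inj₁ p) = bound (subst (+ n ∣_) (value-constant (+ 8)) (vanishes⇒∣ (+ 8 , + 0) p)) ≤60
      go (inj₂ (inj₁ b)) = bound (both-∣ (+ 2) (+ 2) b) ≤60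
      go (inj₂ (inj₂ (p , q))) = bound (eliminate {+ 4} {+ 2} {+ 2} {+ 4} (+ 4) (+ 1) refl p q) ≤60

    tallies⇒bound : (2 ℕ.∣ n → 2 ℕ.∣ k) → EquitableTallies (map vanishes shifts) → n ℕ.< 61
    tallies⇒bound 2∣n⇒2∣k with 2 ℕ.∣? n
    ... | yes 2∣n = tallies⇒bound-even 2∣n (2∣n⇒2∣k 2∣n)
    ... | no ¬2∣n = tallies⇒bound-odd ¬2∣n

    spoked-unless-small : (2 ℕ.∣ n → 2 ℕ.∣ k) → (2 ℕ.∣ n → ¬ Exceptional n k) →
      (n ≡ 5 × k ≡ 2) ⊎ (n ≡ 13 × k ≡ 5) ⊎ (∀ σ → Spoked σ)
    spoked-unless-small 2∣n⇒2∣k ¬X with equitableTallies? (map vanishes shifts)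
    ... | no ¬E = inj₂ (inj₂ (spoked-8 ¬E))
    ... | yes E with small-cases n<61 (ℕ.*-cancelˡ-< 2 k 30 (ℕ.<-≤-trans 2k<n (ℕ.≤-pred n<61))) 1≤k 2k<n 2∣n⇒2∣k E
      where n<61 = tallies⇒bound 2∣n⇒2∣k E
    ... | inj₁ p = inj₁ p
    ... | inj₂ (inj₁ p) = inj₂ (inj₁ p)
    ... | inj₂ (inj₂ (2∣n , X)) = ⊥-elim (¬X 2∣n X)

  even-10 : ∀ x → not (not (not (not (not (not (not (not (not (not x))))))))) ≡ x
  even-10 false = refl
  even-10 true = refl

  -- For (13,5), the walks of length 8 do not distinguish spokes from rim edges.
  spoked-13-5 : (1≤k : 1 ℕ.≤ 5) (2k<n : 10 ℕ.< 13) → ∀ σ → SpokePreservation.Spoked 13 5 1≤k 2k<n σ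
  spoked-13-5 1≤k 2k<n = SpokePreservation.spoked-or-equitable 13 5 1≤k 2k<n 10 even-10 (λ { false → refl ; true → refl }) refl (λ { (() , _) })

  -- Symmetries that preserve spokes

  module Travel (n k : ℕ) {{_ : NonZero n}} (1≤k : 1 ℕ.≤ k) (2k<n : 2 ℕ.* k ℕ.< n) where

    open Residue n
    open Petersen n k 1≤k 2k<n
    open SpokePreservation n k 1≤k 2k<n using (Spoked)

    not^-even : ∀ {r} x → 2 ℕ.∣ r → not^ r x ≡ x
    not^-even x (ℕ.divides q refl) = go q x
      where
      go : ∀ q x → not^ (q ℕ.* 2) x ≡ x
      go zero x = refl
      go (suc q) x = trans (go q (not (not x))) (Bool.not-involutive x)

    not^-odd : ∀ {r} x → ¬ (2 ℕ.∣ r) → not^ r x ≡ not x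
    not^-odd {zero} x ¬2∣r = ⊥-elim (¬2∣r (2 ℕ.∣0))
    not^-odd {suc zero} x ¬2∣r = refl
    not^-odd {suc (suc r)} x ¬2∣r = trans (not^-odd (not (not x)) (λ p → ¬2∣r (ℕ.∣m∣n⇒∣m+n ℕ.∣-refl p))) (Bool.not-involutive (not x))

    τ : DV → DV
    τ (v , x) = v , not x

    travel : ℕ → DV → Letter → DV
    travel zero v l = v
    travel (suc r) v l = travel r (nb v l) l

    flip-rim : ∀ t {l} → l ≢ spoke → flip t l ≡ t
    flip-rim t {fwd} _ = refl
    flip-rim t {bwd} _ = refl
    flip-rim t {spoke} l≢ = ⊥-elim (l≢ refl)

    travel≡ : ∀ r t i x {l} → l ≢ spoke → travel r ((t , i) , x) l ≡ ((t , i ⊕ (+ r * move t l)) , not^ r x)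
    travel≡ zero t i x l≢ = cong (λ j → (t , j) , x) (sym (⊕0 i))
    travel≡ (suc r) t i x {l} l≢ = trans (cong (λ u → travel r ((u , i ⊕ move t l) , not x) l) (flip-rim t l≢))
      (trans (travel≡ r t (i ⊕ move t l) (not x) l≢)
        (cong (λ j → (t , j) , not^ r (not x)) (trans (⊕-assoc i (move t l) _) (cong (i ⊕_) (eq (+ r) (move t l))))))
      where
      eq : ∀ r m → m + r * m ≡ (+ 1 + r) * m
      eq = solve-∀

    back-rim : ∀ {l} → l ≢ spoke → back l ≢ spoke
    back-rim {fwd} _ ()
    back-rim {bwd} _ ()
    back-rim {spoke} l≢ _ = l≢ refl

    back-≢ : ∀ {l} → l ≢ spoke → back l ≢ l
    back-≢ {fwd} _ ()
    back-≢ {bwd} _ ()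
    back-≢ {spoke} l≢ _ = l≢ refl

    back-involutive : ∀ l → back (back l) ≡ l
    back-involutive fwd = refl
    back-involutive bwd = refl
    back-involutive spoke = refl

    rim-opposite : ∀ a b → a ≢ spoke → b ≢ spoke → a ≢ b → a ≡ back b
    rim-opposite spoke _ p _ _ = ⊥-elim (p refl)
    rim-opposite _ spoke _ p _ = ⊥-elim (p refl)
    rim-opposite fwd fwd _ _ p = ⊥-elim (p refl)
    rim-opposite bwd bwd _ _ p = ⊥-elim (p refl)
    rim-opposite fwd bwd _ _ _ = refl
    rim-opposite bwd fwd _ _ _ = refl

    fwd-rim : fwd ≢ spoke
    fwd-rim ()

    bwd-rim : bwd ≢ spoke
    bwd-rim ()

    module _ (σ : Symmetry) (spoked : Spoked σ) where

      open Symmetry σ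

      turn-rim : ∀ v {l} → l ≢ spoke → turn v l ≢ spoke
      turn-rim v l≢ e = l≢ (turn-injective v (trans e (sym (spoked v))))

      turn-back-rim : ∀ v {l} → l ≢ spoke → turn v (back l) ≡ back (turn v l)
      turn-back-rim v {l} l≢ = rim-opposite _ _ (turn-rim v (back-rim l≢)) (turn-rim v l≢) (back-≢ l≢ ∘ turn-injective v)

      -- The letter pointing back is controlled by `turn-back`. As the spoke is preserved at the
      -- next vertex, the forward letter must go to the opposite rim letter, so the image walk
      -- neither leaves its rim nor reverses.
      turn-along : ∀ v {l} → l ≢ spoke → turn (nb v l) l ≡ turn v l
      turn-along v {l} l≢ = begin
        turn (nb v l) l                   ≡⟨ back-involutive _ ⟨
        back (back (turn (nb v l) l))     ≡⟨ cong back (turn-back-rim (nb v l) l≢) ⟨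
        back (turn (nb v l) (back l))     ≡⟨ cong back (turn-back v l) ⟩
        back (back (turn v l))            ≡⟨ back-involutive _ ⟩
        turn v l                          ∎
        where open ≡-Reasoning

      turn-travel : ∀ r v {l} → l ≢ spoke → turn (travel r v l) l ≡ turn v l
      turn-travel zero v l≢ = refl
      turn-travel (suc r) v {l} l≢ = trans (turn-travel r (nb v l) l≢) (turn-along v l≢)

      image-travel : ∀ r v {l} → l ≢ spoke → image (travel r v l) ≡ travel r (image v) (turn v l)
      image-travel zero v l≢ = refl
      image-travel (suc r) v {l} l≢ = trans (image-travel r (nb v l) l≢)
        (cong₂ (travel r) (sym (nb-image v l)) (turn-along v l≢))

      commutes-odd : ¬ (2 ℕ.∣ n) → ∀ v → image (τ v) ≡ τ (image v)
      commutes-odd ¬2∣n v = begin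
        image (τ v)                       ≡⟨ cong image (around v fwd-rim) ⟨
        image (travel n v fwd)            ≡⟨ image-travel n v fwd-rim ⟩
        travel n (image v) (turn v fwd)   ≡⟨ around (image v) (turn-rim v fwd-rim) ⟩
        τ (image v)                       ∎
        where
        open ≡-Reasoning
        -- Both rims have to be covered, since `image` may exchange them: `n` steps of either stride
        -- change the index by a multiple of `n` and, `n` being odd, swap the layer.
        around : ∀ w {l} → l ≢ spoke → travel n w l ≡ τ w
        around ((t , i) , x) {l} l≢ = trans (travel≡ n t i x l≢)
          (cong₂ (λ j y → (t , j) , y) (⊕-zero (divides (move t l) (ℤ.*-comm (+ n) (move t l)))) (not^-odd x ¬2∣n))

      module Even (2∣n : 2 ℕ.∣ n) (2∣k : 2 ℕ.∣ k) where

        hop : DV → Letter → DV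
        hop v l = nb (nb (nb v spoke) l) spoke

        hop≡ : ∀ t i x {l} → l ≢ spoke → hop ((t , i) , x) l ≡ ((t , i ⊕ move (not t) l) , not x)
        hop≡ t i x {l} l≢ = cong₂ _,_ (cong₂ _,_ (trans (cong not (flip-rim (not t) l≢)) (Bool.not-involutive t))
          (trans (⊕0 _) (cong (_⊕ move (not t) l) (⊕0 i)))) (Bool.not-involutive (not x))

        image-hop : ∀ v l → image (hop v l) ≡ hop (image v) (turn (nb v spoke) l)
        image-hop v l = sym (trans (cong (λ w → nb (nb w (turn (nb v spoke) l)) spoke) (nb-spoke v))
          (trans (cong (λ w → nb w spoke) (nb-image (nb v spoke) l)) (nb-spoke _)))
          where
          nb-spoke : ∀ w → nb (image w) spoke ≡ image (nb w spoke)
          nb-spoke w = trans (cong (nb (image w)) (sym (spoked w))) (nb-image w spoke)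

        -- A walk from v to τ v when v is outer and (l , m) is (fwd , bwd) or (bwd , fwd).
        detour : DV → Letter → Letter → DV
        detour v l m = travel k (hop v l) m

        offset : Bool → Letter → Letter → ℤ
        offset t l m = move (not t) l + + k * move t m

        detour≡ : ∀ t i x {l m} → l ≢ spoke → m ≢ spoke → detour ((t , i) , x) l m ≡ ((t , i ⊕ offset t l m) , not x)
        detour≡ t i x {l} {m} l≢ m≢ = trans (cong (λ w → travel k w m) (hop≡ t i x l≢))
          (trans (travel≡ k t _ (not x) m≢)
            (cong₂ (λ j y → (t , j) , y) (⊕-assoc i (move (not t) l) _) (not^-even (not x) 2∣k)))

        detour-τ : ∀ t i x {l m} → l ≢ spoke → m ≢ spoke → offset t l m ≡ + 0 → detour ((t , i) , x) l m ≡ τ ((t , i) , x)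
        detour-τ t i x l≢ m≢ e = trans (detour≡ t i x l≢ m≢) (cong (λ j → (t , j) , not x) (trans (cong (i ⊕_) e) (⊕0 i)))

        image-detour : ∀ v l {m} → m ≢ spoke → image (detour v l m) ≡ detour (image v) (turn (nb v spoke) l) (turn (hop v l) m)
        image-detour v l {m} m≢ = trans (image-travel k (hop v l) m≢) (cong (λ w → travel k w (turn (hop v l) m)) (image-hop v l))

        -- The two hops end at i - k and i + k on the outer rim, in the same layer, and 2k forward
        -- steps lead from one to the other. Directions are constant along a rim walk, so this ties
        -- the choice made in one detour to that in its mirror image.
        turn-hops : ∀ i x → turn (hop ((false , i) , x) bwd) fwd ≡ turn (hop ((false , i) , x) fwd) fwd
        turn-hops i x = begin
          turn (hop v bwd) fwd                             ≡⟨ turn-travel (2 ℕ.* k) (hop v bwd) fwd-rim ⟨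
          turn (travel (2 ℕ.* k) (hop v bwd) fwd) fwd      ≡⟨ cong (λ w → turn w fwd) arrive ⟩
          turn (hop v fwd) fwd                             ∎
          where
          open ≡-Reasoning
          v : DV
          v = (false , i) , x
          eq : ∀ k → - k + + 2 * k * + 1 ≡ k
          eq = solve-∀
          arrive : travel (2 ℕ.* k) (hop v bwd) fwd ≡ hop v fwd
          arrive = trans (cong (λ w → travel (2 ℕ.* k) w fwd) (hop≡ false i x bwd-rim))
            (trans (travel≡ (2 ℕ.* k) false _ (not x) fwd-rim)
            (trans (cong₂ (λ j y → (false , j) , y)
              (trans (⊕-assoc i (- + k) _) (cong (i ⊕_) (trans (cong (λ z → - + k + z * + 1) (ℤ.pos-* 2 k)) (eq (+ k)))))
              (not^-even (not x) (ℕ.∣m⇒∣m*n k ℕ.∣-refl))) (sym (hop≡ false i x fwd-rim))))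

        module Outer (i : Fin n) (x : Bool) where

          v : DV
          v = (false , i) , x

          d e : Letter
          d = turn (nb v spoke) fwd
          e = turn (hop v fwd) bwd

          d-rim : d ≢ spoke
          d-rim = turn-rim (nb v spoke) fwd-rim

          e-rim : e ≢ spoke
          e-rim = turn-rim (hop v fwd) bwd-rim

          image-τ₁ : image (τ v) ≡ detour (image v) d e
          image-τ₁ = trans (cong image (sym (detour-τ false i x fwd-rim bwd-rim (eq (+ k))))) (image-detour v fwd bwd-rim)
            where
            eq : ∀ k → k + k * - + 1 ≡ + 0
            eq = solve-∀

          image-τ₂ : image (τ v) ≡ detour (image v) (back d) (back e)
          image-τ₂ = trans (cong image (sym (detour-τ false i x bwd-rim fwd-rim (eq (+ k)))))
            (trans (image-detour v bwd fwd-rim) (cong₂ (detour (image v)) (turn-back-rim (nb v spoke) fwd-rim)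
              (trans (turn-hops i x) (turn-back-rim (hop v fwd) bwd-rim))))
            where
            eq : ∀ k → - k + k * + 1 ≡ + 0
            eq = solve-∀

          detours : ∀ t j y {l m} → l ≢ spoke → m ≢ spoke → detour ((t , j) , y) l m ≡ detour ((t , j) , y) (back l) (back m) →
            + n ∣ offset t l m - offset t (back l) (back m)
          detours t j y l≢ m≢ e = ⊕-injective (cong (proj₂ ∘ proj₁)
            (trans (sym (detour≡ t j y l≢ m≢)) (trans e (detour≡ t j y (back-rim l≢) (back-rim m≢)))))

          ∣-half : ∀ {z} → + n ∣ + 2 * z → + (n ℕ./ 2) ∣ z
          ∣-half {z} (divides q eq) = divides q (ℤ.*-cancelˡ-≡ (+ 2) z (q * + (n ℕ./ 2)) (trans eq
            (trans (cong (λ m → q * + m) (sym (ℕ.m/n*n≡m 2∣n))) (trans (cong (q *_) (ℤ.pos-* (n ℕ./ 2) 2)) (comm q (+ (n ℕ./ 2)))))))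
            where
            comm : ∀ q m → q * (m * + 2) ≡ + 2 * (q * m)
            comm = solve-∀

          -- As 0 < 4k < 2n, the only multiple of `n` that 4k can equal is `n` itself.
          4k-case : + n ∣ + 4 * + k → Exceptional n k
          4k-case p with ∣⇒∣ᵤ (subst (+ n ∣_) (sym (ℤ.pos-* 4 k)) p)
          ... | ℕ.divides 0 e = ⊥-elim (ℕ.<⇒≱ 1≤k (ℕ.≤-reflexive (ℕ.*-cancelˡ-≡ k 0 4 e)))
          ... | ℕ.divides 1 e = inj₂ (inj₂ (sym (trans e (ℕ.*-identityˡ n))))
          ... | ℕ.divides (suc (suc q)) e = ⊥-elim (ℕ.<⇒≱ (ℕ.*-monoʳ-< 2 2k<n)
            (ℕ.≤-trans (ℕ.*-monoˡ-≤ n (s≤s (s≤s (z≤n {q})))) (ℕ.≤-reflexive (trans (sym e) (ℕ.*-assoc 2 2 k)))))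

          minus-case : + n ∣ + 2 * (+ k * + k - + 1) → Exceptional n k
          minus-case p = inj₁ (∣⇒≋ (subst (λ z → + (n ℕ./ 2) ∣ z - + 1) (sym (ℤ.pos-* k k)) (∣-half p)))

          plus-case : + n ∣ + 2 * (+ k * + k + + 1) → Exceptional n k
          plus-case p = inj₂ (inj₁ (∣⇒≋ (subst (λ z → + (n ℕ./ 2) ∣ z) (trans (cong (_+ + 1) (sym (ℤ.pos-* k k))) (sym (ℤ.+-identityʳ _))) (∣-half p))))

          -- At an outer vertex opposite letters give offset 0, hence τ, while equal letters give
          -- offsets 2k and -2k, which coincide only if n | 4k. At an inner vertex the hop has
          -- length 1 and each of the `k` steps length k; the offsets are 1 - k² or 1 + k² up to
          -- sign, and an offset coincides with its negative only if n | 2(k² - 1) or n | 2(k² + 1).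
          compare : ∀ w l m → l ≢ spoke → m ≢ spoke → detour w l m ≡ detour w (back l) (back m) →
            detour w l m ≡ τ w ⊎ Exceptional n k
          compare ((t , j) , y) spoke _ l≢ _ _ = ⊥-elim (l≢ refl)
          compare ((t , j) , y) _ spoke _ m≢ _ = ⊥-elim (m≢ refl)
          compare ((false , j) , y) fwd bwd l≢ m≢ _ = inj₁ (detour-τ false j y l≢ m≢ (eq (+ k)))
            where
            eq : ∀ k → k + k * - + 1 ≡ + 0
            eq = solve-∀
          compare ((false , j) , y) bwd fwd l≢ m≢ _ = inj₁ (detour-τ false j y l≢ m≢ (eq (+ k)))
            where
            eq : ∀ k → - k + k * + 1 ≡ + 0
            eq = solve-∀
          compare ((false , j) , y) fwd fwd l≢ m≢ e = inj₂ (4k-case (∣-lin₁ (+ 1) (detours false j y l≢ m≢ e) (eq (+ k))))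
            where
            eq : ∀ k → + 4 * k ≡ + 1 * ((k + k * + 1) - (- k + k * - + 1))
            eq = solve-∀
          compare ((false , j) , y) bwd bwd l≢ m≢ e = inj₂ (4k-case (∣-lin₁ (- + 1) (detours false j y l≢ m≢ e) (eq (+ k))))
            where
            eq : ∀ k → + 4 * k ≡ - + 1 * ((- k + k * - + 1) - (k + k * + 1))
            eq = solve-∀
          compare ((true , j) , y) fwd fwd l≢ m≢ e = inj₂ (plus-case (∣-lin₁ (+ 1) (detours true j y l≢ m≢ e) (eq (+ k))))
            where
            eq : ∀ k → + 2 * (k * k + + 1) ≡ + 1 * ((+ 1 + k * k) - (- + 1 + k * - k))
            eq = solve-∀
          compare ((true , j) , y) bwd bwd l≢ m≢ e = inj₂ (plus-case (∣-lin₁ (- + 1) (detours true j y l≢ m≢ e) (eq (+ k))))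
            where
            eq : ∀ k → + 2 * (k * k + + 1) ≡ - + 1 * ((- + 1 + k * - k) - (+ 1 + k * k))
            eq = solve-∀
          compare ((true , j) , y) fwd bwd l≢ m≢ e = inj₂ (minus-case (∣-lin₁ (- + 1) (detours true j y l≢ m≢ e) (eq (+ k))))
            where
            eq : ∀ k → + 2 * (k * k - + 1) ≡ - + 1 * ((+ 1 + k * - k) - (- + 1 + k * k))
            eq = solve-∀
          compare ((true , j) , y) bwd fwd l≢ m≢ e = inj₂ (minus-case (∣-lin₁ (+ 1) (detours true j y l≢ m≢ e) (eq (+ k))))
            where
            eq : ∀ k → + 2 * (k * k - + 1) ≡ + 1 * ((- + 1 + k * k) - (+ 1 + k * - k))
            eq = solve-∀

          commutes-outer : ¬ Exceptional n k → image (τ v) ≡ τ (image v)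
          commutes-outer ¬X with compare (image v) d e d-rim e-rim (trans (sym image-τ₁) image-τ₂)
          ... | inj₁ p = trans image-τ₁ p
          ... | inj₂ X = ⊥-elim (¬X X)

        commutes-even : ¬ Exceptional n k → ∀ v → image (τ v) ≡ τ (image v)
        commutes-even ¬X ((false , i) , x) = Outer.commutes-outer i x ¬X
        -- The claim passes from an outer vertex to its inner neighbour because spokes go to spokes.
        commutes-even ¬X v@((true , i) , x) = begin
          image (τ v)                       ≡⟨ cong (image ∘ τ) (nb-back v spoke) ⟨
          image (τ (nb u spoke))            ≡⟨ nb-image (τ u) spoke ⟨
          nb (image (τ u)) (turn (τ u) spoke)  ≡⟨ cong₂ nb (Outer.commutes-outer (i ⊕ + 0) (not x) ¬X) (trans (spoked (τ u)) (sym (spoked u))) ⟩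
          τ (nb (image u) (turn u spoke))   ≡⟨ cong τ (nb-image u spoke) ⟩
          τ (image (nb u spoke))            ≡⟨ cong (τ ∘ image) (nb-back v spoke) ⟩
          τ (image v)                       ∎
          where
          open ≡-Reasoning
          u = nb v spoke

  -- The Desargues graph and commutation with τ

  ∀ᴸ? : ∀ {P : Letter → Set} → (∀ l → Dec (P l)) → Dec (∀ l → P l)
  ∀ᴸ? P? = map′ (λ { (p , q , r) fwd → p ; (p , q , r) bwd → q ; (p , q , r) spoke → r }) (λ p → p fwd , p bwd , p spoke)
    (P? fwd ×-dec P? bwd ×-dec P? spoke)

  ∃ᴸ? : ∀ {P : Letter → Set} → (∀ l → Dec (P l)) → Dec (∃ P)
  ∃ᴸ? P? = map′ (λ { (inj₁ p) → fwd , p ; (inj₂ (inj₁ p)) → bwd , p ; (inj₂ (inj₂ p)) → spoke , p })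
    (λ { (fwd , p) → inj₁ p ; (bwd , p) → inj₂ (inj₁ p) ; (spoke , p) → inj₂ (inj₂ p) })
    (P? fwd ⊎-dec P? bwd ⊎-dec P? spoke)

  -- In the Desargues graph D(GP(5,2)), τ v is the only vertex of the other colour at distance greater than 3 from v.
  module Desargues (1≤k : 1 ℕ.≤ 2) (2k<n : 4 ℕ.< 5) where

    open Residue 5
    open Petersen 5 2 1≤k 2k<n
    open Travel 5 2 1≤k 2k<n

    nb³ : DV → Letter → Letter → Letter → DV
    nb³ v a b c = nb (nb (nb v a) b) c

    opaque
      unfolding ⟦_⟧ _⊕_

      near-or-τ : ∀ t i x t′ j → ((t′ , j) , not x) ≡ τ ((t , i) , x) ⊎ (∃ λ a → ∃ λ b → ∃ λ c → nb³ ((t , i) , x) a b c ≡ ((t′ , j) , not x))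
      near-or-τ = from-yes (∀ᵇ? λ t → Fin.all? λ i → ∀ᵇ? λ x → ∀ᵇ? λ t′ → Fin.all? λ j →
        (((t′ , j) , not x) ≟ᴰ τ ((t , i) , x)) ⊎-dec
        (∃ᴸ? λ a → ∃ᴸ? λ b → ∃ᴸ? λ c → nb³ ((t , i) , x) a b c ≟ᴰ ((t′ , j) , not x)))

      τ-far : ∀ t i x a b c → nb³ ((t , i) , x) a b c ≢ τ ((t , i) , x)
      τ-far = from-yes (∀ᵇ? λ t → Fin.all? λ i → ∀ᵇ? λ x → ∀ᴸ? λ a → ∀ᴸ? λ b → ∀ᴸ? λ c → ¬? (nb³ ((t , i) , x) a b c ≟ᴰ τ ((t , i) , x)))

    module _ (σ : Symmetry) where

      open Symmetry σ

      colour-travel : ∀ r v l → proj₂ (image (travel r v l)) ≡ not^ r (proj₂ (image v))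
      colour-travel zero v l = refl
      colour-travel (suc r) v l = trans (colour-travel r (nb v l) l) (cong (not^ r ∘ proj₂) (sym (nb-image v l)))

      -- A symmetry may exchange the layers, but every step changes the layer on both sides, and
      -- five rim steps lead from `v` to `τ v`.
      colour-τ : ∀ v → proj₂ (image (τ v)) ≡ not (proj₂ (image v))
      colour-τ v@((t , i) , x) = begin
        proj₂ (image (τ v))              ≡⟨ cong (proj₂ ∘ image) (trans (travel≡ 5 t i x fwd-rim) (cong₂ (λ j y → (t , j) , y)
                                              (⊕-zero (divides (move t fwd) (ℤ.*-comm (+ 5) (move t fwd)))) (not^-odd {5} x (from-no (2 ℕ.∣? 5))))) ⟨
        proj₂ (image (travel 5 v fwd))   ≡⟨ colour-travel 5 v fwd ⟩
        not^ 5 (proj₂ (image v))         ≡⟨ not^-odd {5} _ (from-no (2 ℕ.∣? 5)) ⟩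
        not (proj₂ (image v))            ∎
        where open ≡-Reasoning

      -- Surjectivity of `turn` allows a walk that starts at an image to be pulled back one step at
      -- a time.
      lift³ : ∀ v a b c → ∃ λ a′ → ∃ λ b′ → ∃ λ c′ → nb³ (image v) a b c ≡ image (nb³ v a′ b′ c′)
      lift³ v a b c with turn-surjective v a
      ... | a′ , refl with turn-surjective (nb v a′) b
      ... | b′ , refl with turn-surjective (nb (nb v a′) b′) c
      ... | c′ , refl = a′ , b′ , c′ , trans
        (cong (λ w → nb (nb w (turn (nb v a′) b′)) (turn (nb (nb v a′) b′) c′)) (nb-image v a′))
        (trans (cong (λ w → nb w (turn (nb (nb v a′) b′) c′)) (nb-image (nb v a′) b′)) (nb-image _ c′))

      -- By `colour-τ` the image of `τ v` lies in the layer opposite to `image v`. Were it not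
      -- `τ (image v)`, three steps would lead to it from `image v`; pulled back, they would lead
      -- from `v` to `τ v`.
      commutes-desargues : ∀ v → image (τ v) ≡ τ (image v)
      commutes-desargues v@((t , i) , x) = go (image v) refl (image (τ v)) refl
        where
        go : ∀ w → image v ≡ w → ∀ y → image (τ v) ≡ y → y ≡ τ w
        go ((t₁ , i₁) , x₁) e ((t₂ , i₂) , x₂) e′
          with trans (sym (cong proj₂ e′)) (trans (colour-τ v) (cong (not ∘ proj₂) e))
        ... | refl with near-or-τ t₁ i₁ x₁ t₂ i₂
        ... | inj₁ p = p
        ... | inj₂ (a , b , c , p) with lift³ v a b c
        ... | a′ , b′ , c′ , q = ⊥-elim (τ-far t i x a′ b′ c′ (injective
          (trans (sym q) (trans (cong (λ w → nb³ w a b c) e) (trans p (sym e′))))))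

  commutes : ∀ n k {{_ : NonZero n}} (1≤k : 1 ℕ.≤ k) (2k<n : 2 ℕ.* k ℕ.< n) →
    (2 ℕ.∣ n → 2 ℕ.∣ k) → (2 ℕ.∣ n → ¬ Exceptional n k) →
    let open Petersen n k 1≤k 2k<n
        open Travel n k 1≤k 2k<n using (τ)
    in
    ∀ σ v → Symmetry.image σ (τ v) ≡ τ (Symmetry.image σ v)
  commutes n k 1≤k 2k<n 2∣n⇒2∣k ¬X σ v with SpokePreservation.spoked-unless-small n k 1≤k 2k<n 2∣n⇒2∣k ¬X
  ... | inj₁ (refl , refl) = Desargues.commutes-desargues 1≤k 2k<n σ v
  ... | inj₂ s with 2 ℕ.∣? n | spoked n k 1≤k 2k<n s σ
    where
    spoked : ∀ n k {{_ : NonZero n}} (1≤k : 1 ℕ.≤ k) (2k<n : 2 ℕ.* k ℕ.< n) →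
      (n ≡ 13 × k ≡ 5) ⊎ (∀ σ → SpokePreservation.Spoked n k 1≤k 2k<n σ) → ∀ σ → SpokePreservation.Spoked n k 1≤k 2k<n σ
    spoked _ _ 1≤k 2k<n (inj₁ (refl , refl)) = spoked-13-5 1≤k 2k<n
    spoked _ _ _ _ (inj₂ s) = s
  ... | yes 2∣n | p = Travel.Even.commutes-even n k 1≤k 2k<n σ p 2∣n (2∣n⇒2∣k 2∣n) (¬X 2∣n) v
  ... | no ¬2∣n | p = Travel.commutes-odd n k 1≤k 2k<n σ p ¬2∣n v

  -- Stability

  module Properties (n k : ℕ) {{_ : NonZero n}} (1≤k : 1 ℕ.≤ k) (2k<n : 2 ℕ.* k ℕ.< n) where

    open Residue n
    open Petersen n k 1≤k 2k<n
    open Travel n k 1≤k 2k<n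

    _++ʷ_ : ∀ {G : Graph} {u v w} → Walk G u v → Walk G v w → Walk G u w
    here ++ʷ q = q
    step a p ++ʷ q = step a (p ++ʷ q)

    outer-walk : ∀ r i → Walk (GP n k) (false , i) (false , i ⊕ + r)
    outer-walk zero i = subst (λ j → Walk (GP n k) (false , i) (false , j)) (sym (⊕0 i)) here
    outer-walk (suc r) i = step (adjG (false , i) fwd)
      (subst (λ j → Walk (GP n k) (false , i ⊕ + 1) (false , j)) (⊕-assoc i (+ 1) (+ r)) (outer-walk r (i ⊕ + 1)))

    ⊕-difference : ∀ i j → i ⊕ + toℕ ⟦ + toℕ j - + toℕ i ⟧ ≡ j
    ⊕-difference i j = trans (⊕≡⟦⟧ i _) (trans (⟦⟧-cong (∣-lin₁ (+ 1) (⟦⟧-≈ (+ toℕ j - + toℕ i)) (eq (+ toℕ i) (+ toℕ j) (+ toℕ ⟦ + toℕ j - + toℕ i ⟧)))) (⟦toℕ⟧ j))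
      where
      eq : ∀ x y r → x + r - y ≡ + 1 * (r - (y - x))
      eq = solve-∀

    connected : Connected (GP n k)
    connected (t , i) (t′ , j) = leave t ++ʷ (subst (λ j → Walk (GP n k) (false , i) (false , j)) (⊕-difference i j) (outer-walk _ i) ++ʷ enter t′)
      where
      leave : ∀ t → Walk (GP n k) (t , i) (false , i)
      leave false = here
      leave true = step vu here
      enter : ∀ t → Walk (GP n k) (false , j) (t , j)
      enter false = here
      enter true = step uv here

    -- The rim steps from u₀ to u_k, the edge u_k v_k, the edge v_k v₀ and the spoke at v₀ form a closed walk of odd length k + 3.
    ¬bipartite : 2 ℕ.∣ k → ¬ Bipartite (GP n k)
    ¬bipartite 2∣k (c , proper) = Bool.not-¬ refl (begin
      c (true , o)                 ≡⟨ alternate (false , o) (true , o) uv ⟨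
      not (c (false , o))          ≡⟨ cong not (around k o) ⟨
      not (not^ k (c (false , j))) ≡⟨ cong not (not^-even _ 2∣k) ⟩
      not (c (false , j))          ≡⟨ alternate (false , j) (true , j) uv ⟩
      c (true , j)                 ≡⟨ alternate (true , o) (true , j) (adjG (true , o) fwd) ⟨
      not (c (true , o))           ∎)
      where
      open ≡-Reasoning
      o j : Fin n
      o = ⟦ + 0 ⟧
      j = o ⊕ + k
      alternate : ∀ v w → GPAdj n k v w → not (c v) ≡ c w
      alternate v w a = sym (Bool.¬-not (proper v w a ∘ sym))
      around : ∀ r i → not^ r (c (false , i ⊕ + r)) ≡ c (false , i)
      around zero i = cong (λ j → c (false , j)) (⊕0 i)
      around (suc r) i = begin
        not^ r (not (c (false , i ⊕ + suc r)))        ≡⟨ not^-not r _ ⟩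
        not (not^ r (c (false , i ⊕ + suc r)))        ≡⟨ cong (λ j → not (not^ r (c (false , j)))) (⊕-assoc i (+ 1) (+ r)) ⟨
        not (not^ r (c (false , i ⊕ + 1 ⊕ + r)))      ≡⟨ cong not (around r (i ⊕ + 1)) ⟩
        not (c (false , i ⊕ + 1))                     ≡⟨ cong not (alternate (false , i) (false , i ⊕ + 1) (adjG (false , i) fwd)) ⟨
        not (not (c (false , i)))                     ≡⟨ Bool.not-involutive _ ⟩
        c (false , i)                                 ∎
        where
        not^-not : ∀ r x → not^ r (not x) ≡ not (not^ r x)
        not^-not zero x = refl
        not^-not (suc r) x = not^-not r (not x)

    spoke-end : ∀ {t i j} → GPAdj n k (t , i) (not t , j) → i ≡ j
    spoke-end {false} uv = refl
    spoke-end {true} vu = refl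

    -- An outer vertex has two distinct outer neighbours, an inner vertex only the one at the end of
    -- its spoke.
    outer≢inner : ∀ i j → ¬ (∀ w → GPAdj n k (false , i) w → GPAdj n k (true , j) w)
    outer≢inner i j same = ∤2stride false (⊕-injective
      (trans (sym (spoke-end (same _ (adjG (false , i) fwd)))) (spoke-end (same _ (adjG (false , i) bwd)))))

    vertexDetermining : VertexDetermining (GP n k)
    vertexDetermining (false , i) (false , j) same = cong (false ,_) (sym (spoke-end (Equivalence.to (same (true , i)) uv)))
    vertexDetermining (true , i) (true , j) same = cong (true ,_) (sym (spoke-end (Equivalence.to (same (false , i)) vu)))
    vertexDetermining (false , i) (true , j) same = ⊥-elim (outer≢inner i j (Equivalence.to ∘ same))
    vertexDetermining (true , i) (false , j) same = ⊥-elim (outer≢inner j i (Equivalence.from ∘ same))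

    module _ (commute : ∀ σ v → Symmetry.image σ (τ v) ≡ τ (Symmetry.image σ v)) where

      -- Commutation with τ makes φ act on fibres, with a layer change `κ` that could still depend
      -- on the vertex. Adjacent vertices must have the same `κ`, and the graph is connected.
      stable : Stable (GP n k)
      stable φ = σ , κ (false , ⟦ + 0 ⟧) , decompose
        where
        inv-τ : ∀ v → inv φ (τ v) ≡ τ (inv φ v)
        inv-τ v = trans (cong (inv φ ∘ τ) (sym (inv-right φ v)))
          (trans (cong (inv φ) (sym (commute (symmetry φ) (inv φ v)))) (inv-left φ (τ (inv φ v))))

        π π⁻¹ : GV → GV
        π v = proj₁ (fun φ (v , false))
        π⁻¹ v = proj₁ (inv φ (v , false))

        κ : GV → Bool
        κ v = proj₂ (fun φ (v , false))

        fun-split : ∀ v x → fun φ (v , x) ≡ (π v , x xor κ v)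
        fun-split v false = refl
        fun-split v true = commute (symmetry φ) (v , false)

        inv-proj : ∀ v x → proj₁ (inv φ (v , x)) ≡ π⁻¹ v
        inv-proj v false = refl
        inv-proj v true = cong proj₁ (inv-τ (v , false))

        π-adj : ∀ {u v} → GPAdj n k u v → GPAdj n k (π u) (π v) × κ u ≡ κ v
        π-adj {u} {v} a with Equivalence.to (adj φ (u , false) (v , true)) (a , λ ())
        ... | b , c = subst (GPAdj n k (π u)) (cong proj₁ (fun-split v true)) b ,
          trans (Bool.¬-not c) (trans (cong (not ∘ proj₂) (fun-split v true)) (Bool.not-involutive (κ v)))

        adj-π : ∀ {u v} → GPAdj n k (π u) (π v) → GPAdj n k u v
        -- The lift of `v` is chosen so that the images of the two lifts lie in different layers;
        -- adjacency can then be pulled back along φ.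
        adj-π {u} {v} a with κ u Bool.≟ κ v
        ... | no κ≢ = proj₁ (Equivalence.from (adj φ (u , false) (v , false)) (a , κ≢))
        ... | yes κ≡ = proj₁ (Equivalence.from (adj φ (u , false) (v , true))
          (subst (Adj D (fun φ (u , false))) (sym (fun-split v true)) (a , λ e → Bool.not-¬ refl (trans (sym κ≡) e))))

        σ : Aut (GP n k)
        σ = record
          { fun = π
          ; inv = π⁻¹
          ; inv-left = λ v → trans (sym (inv-proj (π v) (κ v))) (cong proj₁ (inv-left φ (v , false)))
          ; inv-right = λ v → trans (sym (cong proj₁ (fun-split (π⁻¹ v) (proj₂ (inv φ (v , false)))))) (cong proj₁ (inv-right φ (v , false)))
          ; adj = λ u v → mk⇔ (proj₁ ∘ π-adj) adj-π
          }

        κ-constant : ∀ {u v} → Walk (GP n k) u v → κ u ≡ κ v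
        κ-constant here = refl
        κ-constant (step a p) = trans (proj₂ (π-adj a)) (κ-constant p)

        decompose : ∀ v x → fun φ (v , x) ≡ (π v , x xor κ (false , ⟦ + 0 ⟧))
        decompose v x = trans (fun-split v x) (cong (λ c → π v , x xor c) (κ-constant (connected v (false , ⟦ + 0 ⟧))))

  -- Automorphisms that do not commute with τ

  odd : ℕ → Bool
  odd zero = false
  odd (suc m) = not (odd m)

  odd-+ : ∀ m n → odd (m ℕ.+ n) ≡ odd m xor odd n
  odd-+ zero n = refl
  odd-+ (suc m) n = trans (cong not (odd-+ m n)) (Bool.not-distribˡ-xor (odd m) (odd n))

  odd-* : ∀ m n → odd (m ℕ.* n) ≡ odd m ∧ odd n
  odd-* zero n = refl
  odd-* (suc m) n = trans (odd-+ n (m ℕ.* n)) (trans (cong (odd n xor_) (odd-* m n)) (eq (odd m) (odd n)))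
    where
    eq : ∀ x y → y xor (x ∧ y) ≡ not x ∧ y
    eq false y = Bool.xor-identityʳ y
    eq true y = Bool.xor-same y

  odd-∣⊖∣ : ∀ m n → odd ∣ m ⊖ n ∣ ≡ odd m xor odd n
  odd-∣⊖∣ zero zero = refl
  odd-∣⊖∣ zero (suc n) = refl
  odd-∣⊖∣ (suc m) zero = sym (Bool.xor-identityʳ _)
  odd-∣⊖∣ (suc m) (suc n) = trans (cong (odd ∘ ∣_∣) (ℤ.[1+m]⊖[1+n]≡m⊖n m n)) (trans (odd-∣⊖∣ m n) (eq (odd m) (odd n)))
    where
    eq : ∀ x y → x xor y ≡ not x xor not y
    eq false y = sym (Bool.not-involutive y)
    eq true y = refl

  parity : ℤ → Bool
  parity z = odd ∣ z ∣

  parity-+ : ∀ y z → parity (y + z) ≡ parity y xor parity z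
  parity-+ (+ m) (+ n) = odd-+ m n
  parity-+ (+ m) -[1+ n ] = odd-∣⊖∣ m (suc n)
  parity-+ -[1+ m ] (+ n) = trans (odd-∣⊖∣ n (suc m)) (Bool.xor-comm (odd n) _)
  parity-+ -[1+ m ] -[1+ n ] = trans (cong (not ∘ not) (odd-+ m n)) (eq (odd m) (odd n))
    where
    eq : ∀ x y → not (not (x xor y)) ≡ not x xor not y
    eq false y = refl
    eq true y = Bool.not-involutive (not y)

  parity-* : ∀ y z → parity (y * z) ≡ parity y ∧ parity z
  parity-* y z = trans (cong odd (ℤ.abs-* y z)) (odd-* ∣ y ∣ ∣ z ∣)

  parity-neg : ∀ z → parity (- z) ≡ parity z
  parity-neg z = cong odd (ℤ.∣-i∣≡∣i∣ z)

  odd-2∣ : ∀ {m} → 2 ℕ.∣ m → odd m ≡ false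
  odd-2∣ {m} (ℕ.divides q refl) = trans (odd-* q 2) (Bool.∧-zeroʳ (odd q))

  2∣-even : ∀ m → odd m ≡ false → 2 ℕ.∣ m
  2∣-even zero _ = 2 ℕ.∣0
  2∣-even (suc (suc m)) e = ℕ.∣m∣n⇒∣m+n ℕ.∣-refl (2∣-even m (trans (sym (Bool.not-involutive (odd m))) e))

  odd-2∤ : ∀ {m} → ¬ (2 ℕ.∣ m) → odd m ≡ true
  odd-2∤ {m} ¬2∣m = Bool.¬-not (¬2∣m ∘ 2∣-even m)

  even-∣ : ∀ z → parity z ≡ false → + 2 ∣ z
  even-∣ z e = ∣ᵤ⇒∣ (2∣-even ∣ z ∣ e)

  module Unstability (n k : ℕ) {{_ : NonZero n}} (1≤k : 1 ℕ.≤ k) (2k<n : 2 ℕ.* k ℕ.< n) (2∣n : 2 ℕ.∣ n) where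

    open Residue n
    open Petersen n k 1≤k 2k<n
    open Travel n k 1≤k 2k<n using (flip-rim; back-rim; fwd-rim; bwd-rim)

    -- The parity of an index depends only on its residue because `n` is even.
    parity-≈ : ∀ y z → + n ∣ y - z → parity y ≡ parity z
    parity-≈ y z p = xor-≡ (trans (cong (parity y xor_) (sym (parity-neg z))) (trans (sym (parity-+ y (- z)))
      (odd-2∣ (ℕ.∣-trans 2∣n (∣⇒∣ᵤ p)))))
      where
      xor-≡ : ∀ {x y} → x xor y ≡ false → x ≡ y
      xor-≡ {false} e = sym e
      xor-≡ {true} {true} _ = refl

    parity-⊕ : ∀ i z → parity (+ toℕ (i ⊕ z)) ≡ parity (+ toℕ i) xor parity z
    parity-⊕ i z = trans (parity-≈ (+ toℕ (i ⊕ z)) (+ toℕ i + z) (⊕-≈ i z)) (parity-+ (+ toℕ i) z)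

    -- class v is the parity of i + x when v is (u_i , x) or the spoke neighbour (v_i , x + 1) of (u_i , x).
    class : DV → Bool
    class ((t , i) , x) = parity (+ toℕ i) xor (x xor t)

    class-nb : ∀ t i x l → class (nb ((t , i) , x) l) ≡ (parity (+ toℕ i) xor parity (move t l)) xor (not x xor flip t l)
    class-nb t i x l = cong (_xor (not x xor flip t l)) (parity-⊕ i (move t l))

    class-spoke : ∀ v → class (nb v spoke) ≡ class v
    class-spoke ((t , i) , x) = trans (class-nb t i x spoke) (eq (parity (+ toℕ i)) x t)
      where
      eq : ∀ p x t → (p xor false) xor (not x xor not t) ≡ p xor (x xor t)
      eq p x t = cong₂ _xor_ (Bool.xor-identityʳ p) (Bool.xor-annihilates-not x t)

    toggle : ∀ p x t → (p xor true) xor (not x xor t) ≡ p xor (x xor t)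
    toggle false false t = Bool.not-involutive t
    toggle false true t = refl
    toggle true false t = refl
    toggle true true t = sym (Bool.not-involutive t)

    class-outer : ∀ i x {l} → l ≢ spoke → class (nb ((false , i) , x) l) ≡ class ((false , i) , x)
    class-outer i x {fwd} _ = trans (class-nb false i x fwd) (toggle (parity (+ toℕ i)) x false)
    class-outer i x {bwd} _ = trans (class-nb false i x bwd) (toggle (parity (+ toℕ i)) x false)
    class-outer i x {spoke} l≢ = ⊥-elim (l≢ refl)

    Homomorphic : (DV → DV) → Set
    Homomorphic f = ∀ v l → ∃ λ m → f (nb v l) ≡ nb (f v) m

    -- A homomorphism whose fourth power is the identity has its cube as inverse, so adjacency is
    -- reflected as well. The exponent 4 suits both the involutions and the exchange of rims, whose
    -- square need not be trivial.
    automorphism : ∀ f → Homomorphic f → (∀ v → f (f (f (f v))) ≡ v) → Aut D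
    automorphism f hom f⁴ = record
      { fun = f
      ; inv = f ∘ f ∘ f
      ; inv-left = f⁴
      ; inv-right = f⁴
      ; adj = λ v w → mk⇔ to (λ a → subst₂ (Adj D) (f⁴ v) (f⁴ w) (to (to (to a))))
      }
      where
      to : ∀ {v w} → Adj D v w → Adj D (f v) (f w)
      to {v} a with letterD a
      ... | l , refl with hom v l
      ... | m , e = subst (Adj D (f v)) (sym e) (adjD (f v) m)

    unstable : ∀ f → Homomorphic f → (∀ v → f (f (f (f v))) ≡ v) →
      ∀ v → proj₁ (f (v , false)) ≢ proj₁ (f (v , true)) → Unstable (GP n k)
    unstable f hom f⁴ v f≢ stable with stable (automorphism f hom f⁴)
    ... | σ , c , e = f≢ (trans (cong proj₁ (e v false)) (sym (cong proj₁ (e v true))))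

    ⊕⊕-cong : ∀ i {a b c d} → + n ∣ (a + b) - (c + d) → i ⊕ a ⊕ b ≡ i ⊕ c ⊕ d
    ⊕⊕-cong i {a} {b} {c} {d} p = trans (⊕-assoc i a b) (trans (⊕-cong p) (sym (⊕-assoc i c d)))

    ⊕⊕-comm : ∀ i a b → i ⊕ a ⊕ b ≡ i ⊕ b ⊕ a
    ⊕⊕-comm i a b = ⊕⊕-cong i (divides (+ 0) (eq a b))
      where
      eq : ∀ a b → (a + b) - (b + a) ≡ + 0
      eq = solve-∀

    -- Unstable graphs with n and k even

    module EvenStride (2∣k : 2 ℕ.∣ k) where

      -- An inner step changes the layer but, `k` being even, not the parity of the index. Thus
      -- spokes and outer edges stay inside a class, while every inner edge joins the two classes: a
      -- translation of one class affects only the inner edges.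
      class-inner : ∀ i x {l} → l ≢ spoke → class (nb ((true , i) , x) l) ≡ not (class ((true , i) , x))
      class-inner i x {l} l≢ = trans (class-nb true i x l) (trans
        (cong₂ (λ q t → (parity (+ toℕ i) xor q) xor (not x xor t)) (even l l≢) (flip-rim true l≢))
        (eq (parity (+ toℕ i)) x))
        where
        even : ∀ l → l ≢ spoke → parity (move true l) ≡ false
        even fwd _ = odd-2∣ 2∣k
        even bwd _ = trans (parity-neg (+ k)) (odd-2∣ 2∣k)
        even spoke l≢ = ⊥-elim (l≢ refl)
        eq : ∀ p x → (p xor false) xor (not x xor true) ≡ not (p xor (x xor true))
        eq false false = refl
        eq false true = refl
        eq true false = refl
        eq true true = refl

      -- For n = 4k, adding 2k exchanges i + k and i - k, so one of the two classes may be shifted by 2k.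
      module Quarter (n≡4k : n ≡ 4 ℕ.* k) where

        n≡4*k : + n ≡ + 4 * + k
        n≡4*k = trans (cong +_ n≡4k) (ℤ.pos-* 4 k)

        shift : Bool → ℤ
        shift false = + 0
        shift true = + 2 * + k

        θ : DV → DV
        θ v@((t , i) , x) = (t , i ⊕ shift (class v)) , x

        ∣4k : ∀ q {z} → z ≡ q * (+ 4 * + k) → + n ∣ z
        ∣4k q e = divides q (trans e (cong (q *_) (sym n≡4*k)))

        θ-hom : Homomorphic θ
        θ-hom v@((t , i) , x) spoke = spoke , cong (λ j → (not t , j) , not x)
          (trans (cong (λ e → i ⊕ + 0 ⊕ shift e) (class-spoke v)) (⊕⊕-comm i (+ 0) (shift (class v))))
        θ-hom v@((false , i) , x) fwd = fwd , cong (λ j → (false , j) , not x)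
          (trans (cong (λ e → i ⊕ + 1 ⊕ shift e) (class-outer i x {fwd} λ ())) (⊕⊕-comm i (+ 1) (shift (class v))))
        θ-hom v@((false , i) , x) bwd = bwd , cong (λ j → (false , j) , not x)
          (trans (cong (λ e → i ⊕ - + 1 ⊕ shift e) (class-outer i x {bwd} λ ())) (⊕⊕-comm i (- + 1) (shift (class v))))
        θ-hom v@((true , i) , x) fwd = bwd , cong (λ j → (true , j) , not x)
          (trans (cong (λ e → i ⊕ + k ⊕ shift e) (class-inner i x {fwd} λ ())) (⊕⊕-cong i (reflected (class v))))
          where
          eq₀ : ∀ k → (k + + 2 * k) - (+ 0 + - k) ≡ + 1 * (+ 4 * k)
          eq₀ = solve-∀
          eq₁ : ∀ k → (k + + 0) - (+ 2 * k + - k) ≡ + 0 * (+ 4 * k)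
          eq₁ = solve-∀
          reflected : ∀ e → + n ∣ (+ k + shift (not e)) - (shift e + - + k)
          reflected false = ∣4k (+ 1) (eq₀ (+ k))
          reflected true = ∣4k (+ 0) (eq₁ (+ k))
        θ-hom v@((true , i) , x) bwd = fwd , cong (λ j → (true , j) , not x)
          (trans (cong (λ e → i ⊕ - + k ⊕ shift e) (class-inner i x {bwd} λ ())) (⊕⊕-cong i (reflected (class v))))
          where
          eq₀ : ∀ k → (- k + + 2 * k) - (+ 0 + k) ≡ + 0 * (+ 4 * k)
          eq₀ = solve-∀
          eq₁ : ∀ k → (- k + + 0) - (+ 2 * k + k) ≡ - + 1 * (+ 4 * k)
          eq₁ = solve-∀
          reflected : ∀ e → + n ∣ (- + k + shift (not e)) - (shift e + + k)
          reflected false = ∣4k (+ 0) (eq₀ (+ k))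
          reflected true = ∣4k (- + 1) (eq₁ (+ k))

        parity-shift : ∀ e → parity (shift e) ≡ false
        parity-shift false = refl
        parity-shift true = parity-* (+ 2) (+ k)

        class-θ : ∀ v → class (θ v) ≡ class v
        class-θ v@((t , i) , x) = cong (_xor (x xor t)) (trans (parity-⊕ i (shift (class v)))
          (trans (cong (parity (+ toℕ i) xor_) (parity-shift (class v))) (Bool.xor-identityʳ (parity (+ toℕ i)))))

        θ² : ∀ v → θ (θ v) ≡ v
        θ² v@((t , i) , x) = cong (λ j → (t , j) , x) (trans (cong (λ e → i ⊕ shift (class v) ⊕ shift e) (class-θ v))
          (trans (⊕-assoc i (shift (class v)) _) (⊕-zero (twice (class v)))))
          where
          eq : ∀ k → + 2 * k + + 2 * k ≡ + 1 * (+ 4 * k)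
          eq = solve-∀
          twice : ∀ e → + n ∣ shift e + shift e
          twice false = divides (+ 0) refl
          twice true = ∣4k (+ 1) (eq (+ k))

        quarter-unstable : Unstable (GP n k)
        quarter-unstable = unstable θ θ-hom (λ v → trans (cong (θ ∘ θ) (θ² v)) (θ² v)) (false , ⟦ + 0 ⟧)
          (λ e → differ (parity (+ toℕ ⟦ + 0 ⟧)) (⊕-injective (cong proj₂ e)))
          where
          ∤2*k : ¬ (+ n ∣ + 2 * + k)
          ∤2*k p = ∤2stride true (subst (+ n ∣_) (sym (ℤ.pos-* 2 k)) p)
          eq₀ : ∀ z → z ≡ - + 1 * (+ 0 - z)
          eq₀ = solve-∀
          eq₁ : ∀ z → z ≡ + 1 * (z - + 0)
          eq₁ = solve-∀
          differ : ∀ p → ¬ (+ n ∣ shift (p xor false) - shift (p xor true))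
          differ false q = ∤2*k (∣-lin₁ (- + 1) q (eq₀ (+ 2 * + k)))
          differ true q = ∤2*k (∣-lin₁ (+ 1) q (eq₁ (+ 2 * + k)))

      -- For k² ≡ ε = ±1 (mod m), where n = 2m, m is odd and k² + m ≡ ε (mod n). The map θ exchanges the
      -- two rims by i ↦ k i on one class and i ↦ k i + m on the other.
      module Half (m : ℕ) (n≡m2 : n ≡ m ℕ.* 2) (m-odd : parity (+ m) ≡ true)
        (ε : Letter) (ε-rim : ε ≢ spoke) (k²+m≡ε : + n ∣ + k * + k + + m - move false ε) where

        n≡m*2 : + n ≡ + m * + 2
        n≡m*2 = trans (cong +_ n≡m2) (ℤ.pos-* m 2)

        n∣m*2 : + n ∣ + m * + 2
        n∣m*2 = divides (+ 1) (trans (sym n≡m*2) (sym (ℤ.*-identityˡ (+ n))))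

        n∣m*even : ∀ {z} → parity z ≡ false → + n ∣ + m * z
        n∣m*even {z} e with even-∣ z e
        ... | divides q refl = ∣-lin₁ q n∣m*2 (eq (+ m) q)
          where
          eq : ∀ m q → m * (q * + 2) ≡ q * (m * + 2)
          eq = solve-∀

        half : Bool → ℤ
        half false = + 0
        half true = + m

        θ : DV → DV
        θ v@((t , i) , x) = (not t , ⟦ + k * + toℕ i + half (class v) ⟧) , x

        ⟦⟧-⊕ : ∀ y d → ⟦ y ⟧ ⊕ d ≡ ⟦ y + d ⟧
        ⟦⟧-⊕ y d = trans (⊕≡⟦⟧ ⟦ y ⟧ d) (⟦⟧-cong (∣-lin₁ (+ 1) (⟦⟧-≈ y) (eq (+ toℕ ⟦ y ⟧) y d)))
          where
          eq : ∀ r y d → (r + d) - (y + d) ≡ + 1 * (r - y)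
          eq = solve-∀

        affine : ∀ i a b c d → + n ∣ (+ k * a + b) - (c + d) → ⟦ + k * + toℕ (i ⊕ a) + b ⟧ ≡ ⟦ + k * + toℕ i + c ⟧ ⊕ d
        affine i a b c d p = trans (⟦⟧-cong (∣-lin₂ (+ k) (+ 1) (⊕-≈ i a) p (eq (+ k) (+ toℕ (i ⊕ a)) (+ toℕ i) a b c d)))
          (sym (⟦⟧-⊕ (+ k * + toℕ i + c) d))
          where
          eq : ∀ k j i a b c d → (k * j + b) - (k * i + c + d) ≡ k * (j - (i + a)) + + 1 * ((k * a + b) - (c + d))
          eq = solve-∀

        move-ε-back : move false (back ε) ≡ - move false ε
        move-ε-back = neg ε ε-rim
          where
          neg : ∀ l → l ≢ spoke → move false (back l) ≡ - move false l
          neg fwd _ = refl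
          neg bwd _ = refl
          neg spoke l≢ = ⊥-elim (l≢ refl)

        -- Outer edges stay in a class and are stretched to length `k`. An inner edge is stretched
        -- to length k², and its change of class supplies the missing `m` in k² + m ≡ ε.
        θ-hom : Homomorphic θ
        θ-hom v@((t , i) , x) spoke = spoke , cong (λ j → (not (not t) , j) , not x)
          (trans (cong (λ e → ⟦ + k * + toℕ (i ⊕ + 0) + half e ⟧) (class-spoke v))
            (affine i (+ 0) (half (class v)) (half (class v)) (+ 0) (divides (+ 0) (eq (+ k) (half (class v))))))
          where
          eq : ∀ k b → (k * + 0 + b) - (b + + 0) ≡ + 0
          eq = solve-∀
        θ-hom v@((false , i) , x) fwd = fwd , cong (λ j → (true , j) , not x)
          (trans (cong (λ e → ⟦ + k * + toℕ (i ⊕ + 1) + half e ⟧) (class-outer i x fwd-rim))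
            (affine i (+ 1) (half (class v)) (half (class v)) (+ k) (divides (+ 0) (eq (+ k) (half (class v))))))
          where
          eq : ∀ k b → (k * + 1 + b) - (b + k) ≡ + 0
          eq = solve-∀
        θ-hom v@((false , i) , x) bwd = bwd , cong (λ j → (true , j) , not x)
          (trans (cong (λ e → ⟦ + k * + toℕ (i ⊕ - + 1) + half e ⟧) (class-outer i x bwd-rim))
            (affine i (- + 1) (half (class v)) (half (class v)) (- + k) (divides (+ 0) (eq (+ k) (half (class v))))))
          where
          eq : ∀ k b → (k * - + 1 + b) - (b + - k) ≡ + 0
          eq = solve-∀
        θ-hom v@((true , i) , x) fwd = ε , cong₂ (λ t j → (t , j) , not x) (sym (flip-rim false ε-rim))
          (trans (cong (λ e → ⟦ + k * + toℕ (i ⊕ + k) + half e ⟧) (class-inner i x fwd-rim))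
            (affine i (+ k) _ _ _ (turned (class v))))
          where
          eq₀ : ∀ k m d → (k * k + m) - (+ 0 + d) ≡ + 1 * (k * k + m - d)
          eq₀ = solve-∀
          eq₁ : ∀ k m d → (k * k + + 0) - (m + d) ≡ + 1 * (k * k + m - d) + - + 1 * (m * + 2)
          eq₁ = solve-∀
          turned : ∀ e → + n ∣ (+ k * + k + half (not e)) - (half e + move false ε)
          turned false = ∣-lin₁ (+ 1) k²+m≡ε (eq₀ (+ k) (+ m) (move false ε))
          turned true = ∣-lin₂ (+ 1) (- + 1) k²+m≡ε n∣m*2 (eq₁ (+ k) (+ m) (move false ε))
        θ-hom v@((true , i) , x) bwd = back ε , cong₂ (λ t j → (t , j) , not x) (sym (flip-rim false (back-rim ε-rim)))
          (trans (cong (λ e → ⟦ + k * + toℕ (i ⊕ - + k) + half e ⟧) (class-inner i x bwd-rim))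
            (affine i (- + k) _ _ _ (turned (class v))))
          where
          eq₀ : ∀ k m d → (k * - k + m) - (+ 0 + - d) ≡ - + 1 * (k * k + m - d) + + 1 * (m * + 2)
          eq₀ = solve-∀
          eq₁ : ∀ k m d → (k * - k + + 0) - (m + - d) ≡ - + 1 * (k * k + m - d)
          eq₁ = solve-∀
          turned : ∀ e → + n ∣ (+ k * - + k + half (not e)) - (half e + move false (back ε))
          turned false = ∣-lin₂ (- + 1) (+ 1) k²+m≡ε n∣m*2
            (trans (cong (λ d → (+ k * - + k + + m) - (+ 0 + d)) move-ε-back) (eq₀ (+ k) (+ m) (move false ε)))
          turned true = ∣-lin₁ (- + 1) k²+m≡ε
            (trans (cong (λ d → (+ k * - + k + + 0) - (+ m + d)) move-ε-back) (eq₁ (+ k) (+ m) (move false ε)))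

        parity-half : ∀ e → parity (half e) ≡ e
        parity-half false = refl
        parity-half true = m-odd

        -- Since `k` is even and `m` is odd, the new index has the parity of `half (class v)`, that
        -- is, the class of `v`; the layer and the rim then cancel.
        class-θ : ∀ t i x → class (θ ((t , i) , x)) ≡ not (parity (+ toℕ i))
        class-θ t i x = begin
          parity (+ toℕ ⟦ + k * + toℕ i + half e ⟧) xor (x xor not t)  ≡⟨ cong (_xor (x xor not t)) parity-image ⟩
          e xor (x xor not t)                                           ≡⟨ eq (parity (+ toℕ i)) x t ⟩
          not (parity (+ toℕ i))                                        ∎
          where
          open ≡-Reasoning
          e : Bool
          e = class ((t , i) , x)
          parity-image : parity (+ toℕ ⟦ + k * + toℕ i + half e ⟧) ≡ e
          parity-image = trans (parity-≈ (+ toℕ ⟦ + k * + toℕ i + half e ⟧) (+ k * + toℕ i + half e) (⟦⟧-≈ (+ k * + toℕ i + half e)))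
            (trans (parity-+ (+ k * + toℕ i) (half e))
              (cong₂ _xor_ (trans (parity-* (+ k) (+ toℕ i)) (cong (_∧ parity (+ toℕ i)) (odd-2∣ 2∣k))) (parity-half e)))
          eq : ∀ p x t → (p xor (x xor t)) xor (x xor not t) ≡ not p
          eq false false false = refl
          eq false false true = refl
          eq false true false = refl
          eq false true true = refl
          eq true false false = refl
          eq true false true = refl
          eq true true false = refl
          eq true true true = refl

        -- Modulo n = 2m the term k · `half` vanishes because `k` is even, and k² i ≡ ε i + m i.
        -- Here m i is 0 or `m` according to the parity of i, and the second translation, given by
        -- `class-θ`, completes it to `m` in either case.
        θ² : ∀ t i x → θ (θ ((t , i) , x)) ≡ ((t , ⟦ move false ε * + toℕ i + + m ⟧) , x)
        θ² t i x = cong₂ (λ t j → (t , j) , x) (Bool.not-involutive t)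
          (trans (cong (λ e → ⟦ + k * + toℕ j + half e ⟧) (class-θ t i x)) (⟦⟧-cong composed))
          where
          e : Bool
          e = class ((t , i) , x)
          I J h h′ d : ℤ
          I = + toℕ i
          h = half e
          h′ = half (not (parity I))
          d = move false ε
          j : Fin n
          j = ⟦ + k * I + h ⟧
          J = + toℕ j
          k*half : ∀ e → + n ∣ + k * half e
          k*half false = divides (+ 0) (ℤ.*-zeroʳ (+ k))
          k*half true = subst (+ n ∣_) (ℤ.*-comm (+ m) (+ k)) (n∣m*even {+ k} (odd-2∣ 2∣k))
          parity-term : ∀ p → parity I ≡ p → + n ∣ half (not p) - + m - + m * I
          parity-term false e = ∣-lin₁ (- + 1) (n∣m*even {I} e) (eq (+ m) I)
            where
            eq : ∀ m i → m - m - m * i ≡ - + 1 * (m * i)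
            eq = solve-∀
          parity-term true e = ∣-lin₁ (- + 1) (n∣m*even {+ 1 + I} (trans (parity-+ (+ 1) I) (cong not e))) (eq (+ m) I)
            where
            eq : ∀ m i → + 0 - m - m * i ≡ - + 1 * (m * (+ 1 + i))
            eq = solve-∀
          eq : ∀ k m d i h h′ j → (k * j + h′) - (d * i + m)
            ≡ + 1 * (+ 1 * (+ 1 * (k * h) + + 1 * (h′ - m - m * i)) + i * (k * k + m - d)) + k * (j - (k * i + h))
          eq = solve-∀
          composed : + n ∣ (+ k * J + h′) - (d * I + + m)
          composed = ∣-lin₂ (+ 1) (+ k)
            (∣-lin₂ (+ 1) I (∣-lin₂ (+ 1) (+ 1) (k*half e) (parity-term (parity I) refl) refl) k²+m≡ε refl)
            (⟦⟧-≈ (+ k * I + h)) (eq (+ k) (+ m) d I h h′ J)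

        θ⁴ : ∀ v → θ (θ (θ (θ v))) ≡ v
        θ⁴ v@((t , i) , x) = trans (cong (θ ∘ θ) (θ² t i x)) (trans (θ² t ⟦ d * I + + m ⟧ x)
          (cong (λ j → (t , j) , x) (trans (⟦⟧-cong (square ε ε-rim)) (⟦toℕ⟧ i))))
          where
          I d : ℤ
          I = + toℕ i
          d = move false ε
          square : ∀ l → l ≢ spoke → + n ∣ (move false l * + toℕ ⟦ move false l * I + + m ⟧ + + m) - I
          square fwd _ = ∣-lin₂ (+ 1) (+ 1) (⟦⟧-≈ (+ 1 * I + + m)) n∣m*2 (eq (+ toℕ ⟦ + 1 * I + + m ⟧) I (+ m))
            where
            eq : ∀ j i m → (+ 1 * j + m) - i ≡ + 1 * (j - (+ 1 * i + m)) + + 1 * (m * + 2)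
            eq = solve-∀
          square bwd _ = ∣-lin₁ (- + 1) (⟦⟧-≈ (- + 1 * I + + m)) (eq (+ toℕ ⟦ - + 1 * I + + m ⟧) I (+ m))
            where
            eq : ∀ j i m → (- + 1 * j + m) - i ≡ - + 1 * (j - (- + 1 * i + m))
            eq = solve-∀
          square spoke l≢ = ⊥-elim (l≢ refl)

        ∤m : ¬ (+ n ∣ + m)
        ∤m = ∤-between (positive m m-odd) (subst (m ℕ.<_) (sym n≡m2) (ℕ.m<m*n m 2 {{ℕ.>-nonZero (positive m m-odd)}} (s≤s (s≤s z≤n))))
          where
          positive : ∀ m → parity (+ m) ≡ true → 0 ℕ.< m
          positive (suc m) _ = s≤s z≤n

        half-unstable : Unstable (GP n k)
        half-unstable = unstable θ θ-hom θ⁴ (false , ⟦ + 0 ⟧)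
          (λ e → differ (parity (+ toℕ ⟦ + 0 ⟧)) (⟦⟧-injective (cong proj₂ e)))
          where
          z : ℤ
          z = + k * + toℕ ⟦ + 0 ⟧
          eq₀ : ∀ z m → m ≡ - + 1 * ((z + + 0) - (z + m))
          eq₀ = solve-∀
          eq₁ : ∀ z m → m ≡ + 1 * ((z + m) - (z + + 0))
          eq₁ = solve-∀
          differ : ∀ p → ¬ (+ n ∣ (z + half (p xor false)) - (z + half (p xor true)))
          differ false q = ∤m (∣-lin₁ (- + 1) q (eq₀ z (+ m)))
          differ true q = ∤m (∣-lin₁ (+ 1) q (eq₁ z (+ m)))

      -- As `k` is even, k² - ε = q m is odd, hence so are q and `m`. Then k² + m - ε = (q + 1) m is
      -- a multiple of 2m = n, so the congruence modulo n / 2 lifts to one modulo `n`.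
      half-unstable : ∀ ε → ε ≢ spoke → + (n ℕ./ 2) ∣ + k * + k - move false ε → Unstable (GP n k)
      half-unstable ε ε-rim (divides q e) = Half.half-unstable m (sym (ℕ.m/n*n≡m 2∣n)) m-odd ε ε-rim (lifted)
        where
        m : ℕ
        m = n ℕ./ 2
        rim-odd : ∀ l → l ≢ spoke → parity (- move false l) ≡ true
        rim-odd fwd _ = refl
        rim-odd bwd _ = refl
        rim-odd spoke l≢ = ⊥-elim (l≢ refl)
        product-odd : parity q ∧ parity (+ m) ≡ true
        product-odd = trans (sym (parity-* q (+ m))) (trans (cong parity (sym e)) (trans (parity-+ (+ k * + k) (- move false ε))
          (cong₂ _xor_ (trans (parity-* (+ k) (+ k)) (cong (_∧ parity (+ k)) (odd-2∣ 2∣k))) (rim-odd ε ε-rim))))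
        q-odd : parity q ≡ true
        q-odd = Bool.∧-conicalˡ (parity q) (parity (+ m)) product-odd
        m-odd : parity (+ m) ≡ true
        m-odd = Bool.∧-conicalʳ (parity q) (parity (+ m)) product-odd
        eq : ∀ x m d → x + m - d ≡ (x - d) + m
        eq = solve-∀
        eq′ : ∀ q′ m → q′ * + 2 * m ≡ q′ * (m * + 2)
        eq′ = solve-∀
        eq″ : ∀ q m → q * m + m ≡ (+ 1 + q) * m
        eq″ = solve-∀
        lifted : + n ∣ + k * + k + + m - move false ε
        lifted with even-∣ (+ 1 + q) (trans (parity-+ (+ 1) q) (cong not q-odd))
        ... | divides q′ e′ = divides q′ (trans (eq (+ k * + k) (+ m) (move false ε)) (trans (cong (_+ + m) e)
          (trans (eq″ q (+ m)) (trans (cong (_* + m) e′) (trans (eq′ q′ (+ m))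
          (cong (q′ *_) (trans (sym (ℤ.pos-* m 2)) (cong +_ (ℕ.m/n*n≡m 2∣n)))))))))

      exceptional-unstable : Exceptional n k → Unstable (GP n k)
      exceptional-unstable (inj₁ p) = half-unstable fwd fwd-rim (subst (λ z → + (n ℕ./ 2) ∣ z - + 1) (ℤ.pos-* k k) (≋⇒∣ p))
      exceptional-unstable (inj₂ (inj₁ p)) = half-unstable bwd bwd-rim
        (subst (λ z → + (n ℕ./ 2) ∣ z) (trans (ℤ.+-identityʳ _) (cong (_+ + 1) (ℤ.pos-* k k))) (≋⇒∣ p))
      exceptional-unstable (inj₂ (inj₂ p)) = Quarter.quarter-unstable p

    -- Unstable graphs with n even and k odd

    module OddStride (¬2∣k : ¬ (2 ℕ.∣ k)) where

      parity-move : ∀ t {l} → l ≢ spoke → parity (move t l) ≡ true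
      parity-move false {fwd} _ = refl
      parity-move false {bwd} _ = refl
      parity-move true {fwd} _ = odd-2∤ ¬2∣k
      parity-move true {bwd} _ = trans (parity-neg (+ k)) (odd-2∤ ¬2∣k)
      parity-move t {spoke} l≢ = ⊥-elim (l≢ refl)

      class-rim : ∀ t i x {l} → l ≢ spoke → class (nb ((t , i) , x) l) ≡ class ((t , i) , x)
      class-rim t i x {l} l≢ = trans (class-nb t i x l) (trans
        (cong₂ (λ q t → (parity (+ toℕ i) xor q) xor (not x xor t)) (parity-move t l≢) (flip-rim t l≢))
        (toggle (parity (+ toℕ i)) x t))

      -- All strides are odd, so parity of the index and layer change together. No edge of D joins
      -- the two classes, and an automorphism may act on one of them alone.
      class-invariant : ∀ v l → class (nb v l) ≡ class v
      class-invariant ((t , i) , x) fwd = class-rim t i x fwd-rim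
      class-invariant ((t , i) , x) bwd = class-rim t i x bwd-rim
      class-invariant v spoke = class-spoke v

      -- Along an edge the class is kept and the layer changes; on returning to layer `false` the
      -- class changes.
      bipartite : Bipartite (GP n k)
      bipartite = (λ v → class (v , false)) , proper
        where
        class-true : ∀ v → class (v , true) ≡ not (class (v , false))
        class-true (t , i) = eq (parity (+ toℕ i)) t
          where
          eq : ∀ p t → p xor not t ≡ not (p xor t)
          eq false t = refl
          eq true t = refl
        proper : ∀ u v → GPAdj n k u v → class (u , false) ≢ class (v , false)
        proper u v a e with letterG a
        ... | l , refl = Bool.not-¬ refl (trans (sym e) (trans (sym (class-invariant (u , false) l)) (class-true (nbG u l))))

      reflect : Bool → Fin n → Fin n
      reflect false i = i
      reflect true i = ⟦ - + toℕ i ⟧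

      θ : DV → DV
      θ v@((t , i) , x) = (t , reflect (class v) i) , x

      back-move : ∀ t l → move t (back l) ≡ - move t l
      back-move t fwd = refl
      back-move t bwd = sym (ℤ.neg-involutive _)
      back-move t spoke = refl

      flip-back-rim : ∀ t l → flip t (back l) ≡ flip t l
      flip-back-rim t fwd = refl
      flip-back-rim t bwd = refl
      flip-back-rim t spoke = refl

      θ-hom : Homomorphic θ
      θ-hom v@((t , i) , x) l with class v | class-invariant v l
      ... | false | e = l , cong (λ c → (flip t l , reflect c (i ⊕ move t l)) , not x) e
      ... | true | e = back l , cong₂ (λ u j → (u , j) , not x) (sym (flip-back-rim t l))
        (trans (cong (λ c → reflect c (i ⊕ move t l)) e) (sym (trans (⊕≡⟦⟧ _ _) (⟦⟧-cong
          (∣-lin₂ (+ 1) (+ 1) (⟦⟧-≈ (- + toℕ i)) (⊕-≈ i (move t l))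
            (trans (cong (λ d → (+ toℕ ⟦ - + toℕ i ⟧ + d) - (- + toℕ (i ⊕ move t l))) (back-move t l))
              (eq (+ toℕ ⟦ - + toℕ i ⟧) (+ toℕ (i ⊕ move t l)) (+ toℕ i) (move t l))))))))
        where
        eq : ∀ r j i d → (r + - d) - (- j) ≡ + 1 * (r - - i) + + 1 * (j - (i + d))
        eq = solve-∀

      class-θ : ∀ v → class (θ v) ≡ class v
      class-θ v@((t , i) , x) = cong (_xor (x xor t)) (parity-reflect (class v))
        where
        parity-reflect : ∀ c → parity (+ toℕ (reflect c i)) ≡ parity (+ toℕ i)
        parity-reflect false = refl
        parity-reflect true = trans (parity-≈ (+ toℕ ⟦ - + toℕ i ⟧) (- + toℕ i) (⟦⟧-≈ (- + toℕ i))) (parity-neg (+ toℕ i))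

      θ² : ∀ v → θ (θ v) ≡ v
      θ² v@((t , i) , x) = cong (λ j → (t , j) , x) (trans (cong (λ c → reflect c (reflect (class v) i)) (class-θ v)) (involutive (class v)))
        where
        eq : ∀ r i → - r - i ≡ - + 1 * (r - - i)
        eq = solve-∀
        involutive : ∀ c → reflect c (reflect c i) ≡ i
        involutive false = refl
        involutive true = trans (⟦⟧-cong (∣-lin₁ (- + 1) (⟦⟧-≈ (- + toℕ i)) (eq (+ toℕ ⟦ - + toℕ i ⟧) (+ toℕ i)))) (⟦toℕ⟧ i)

      odd-stride-unstable : Unstable (GP n k)
      -- The reflection fixes index 0, so the witness has index 1, which would be fixed only if n |
      -- 2.
      odd-stride-unstable = unstable θ θ-hom (λ v → trans (cong (θ ∘ θ) (θ² v)) (θ² v)) (false , ⟦ + 1 ⟧)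
        (λ e → differ (parity (+ toℕ ⟦ + 1 ⟧)) (cong proj₂ e))
        where
        i : Fin n
        i = ⟦ + 1 ⟧
        eq : ∀ i → + 2 ≡ + 1 * (i - - i) + - + 2 * (i - + 1)
        eq = solve-∀
        moved : i ≢ ⟦ - + toℕ i ⟧
        moved e = ∤2stride false (∣-lin₂ (+ 1) (- + 2) (⟦⟧-injective (trans (⟦toℕ⟧ i) e)) (⟦⟧-≈ (+ 1)) (eq (+ toℕ i)))
        differ : ∀ p → reflect (p xor false) i ≢ reflect (p xor true) i
        differ false e = moved e
        differ true e = moved (sym e)

  -- The classification

  module Theorem (n k : ℕ) {{_ : NonZero n}} (1≤k : 1 ℕ.≤ k) (2k<n : 2 ℕ.* k ℕ.< n) where

    open Properties n k 1≤k 2k<n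
    open Unstability n k 1≤k 2k<n

    stable-odd : ¬ (2 ℕ.∣ n) → Stable (GP n k)
    stable-odd ¬2∣n = stable (commutes n k 1≤k 2k<n (⊥-elim ∘ ¬2∣n) (⊥-elim ∘ ¬2∣n))

    stable-even : 2 ℕ.∣ k → ¬ Exceptional n k → Stable (GP n k)
    stable-even 2∣k ¬X = stable (commutes n k 1≤k 2k<n (λ _ → 2∣k) (λ _ → ¬X))

    triviallyUnstable : TriviallyUnstable (GP n k) ⇔ (2 ℕ.∣ n × ¬ (2 ℕ.∣ k))
    triviallyUnstable = mk⇔ to from
      where
      to : TriviallyUnstable (GP n k) → 2 ℕ.∣ n × ¬ (2 ℕ.∣ k)
      to (unstable , trivial) with 2 ℕ.∣? n
      ... | no ¬2∣n = ⊥-elim (unstable (stable-odd ¬2∣n))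
      ... | yes 2∣n = 2∣n , λ 2∣k → trivial (connected , ¬bipartite 2∣k , vertexDetermining)
      from : 2 ℕ.∣ n × ¬ (2 ℕ.∣ k) → TriviallyUnstable (GP n k)
      from (2∣n , ¬2∣k) = OddStride.odd-stride-unstable 2∣n ¬2∣k , λ (_ , ¬b , _) → ¬b (OddStride.bipartite 2∣n ¬2∣k)

    nontriviallyUnstable : 2 ℕ.∣ n → 2 ℕ.∣ k → NontriviallyUnstable (GP n k) ⇔ Exceptional n k
    nontriviallyUnstable 2∣n 2∣k = mk⇔ to
      (λ X → EvenStride.exceptional-unstable 2∣n 2∣k X , connected , ¬bipartite 2∣k , vertexDetermining)
      where
      to : NontriviallyUnstable (GP n k) → Exceptional n k
      to (unstable , _) with exceptional? n k
      ... | yes X = X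
      ... | no ¬X = ⊥-elim (unstable (stable-even 2∣k ¬X))

open import Data.Nat using (ℕ; _+_; _*_; _≤_; _<_; _/_)
open import Data.Nat.Divisibility using (_∣_)
open import Data.Product using (_×_)
open import Data.Sum using (_⊎_)
open import Relation.Binary.PropositionalEquality using (_≡_)
open import Relation.Nullary using (¬_)
open import Function.Bundles using (_⇔_)

open import Data.Nat using (zero; suc)
open import Data.Product using (_,_)

theorem1p2 : (n k : ℕ) → 1 ≤ k → 2 * k < n →
    ((¬ (2 ∣ n)) → Stable (GP n k))
    × (TriviallyUnstable (GP n k) ⇔ ((2 ∣ n) × (¬ (2 ∣ k))))
    × ((2 ∣ n) → (2 ∣ k) →
    (NontriviallyUnstable (GP n k)
    ⇔ ((k * k ≋ 1 [mod n / 2 ]) ⊎ (k * k + 1 ≋ 0 [mod n / 2 ]) ⊎ (n ≡ 4 * k))))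
theorem1p2 zero _ _ ()
theorem1p2 n@(suc _) k 1≤k 2k<n = stable-odd , triviallyUnstable , nontriviallyUnstable
  where open GeneralizedPetersen.Theorem n k 1≤k 2k<n
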